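{- Let $G=(V,E)$ be a finite strongly connected simple directed graph with the property that $\mathbb{P}(L(u,v)) = \mathbb{P}(L(u,w))$ for any three distinct vertices $u,v,w\in V$. Then every edge of $G$ is bidirected, that is, for all $u,v\in V$, if $uv\in E$ then $vu\in E$.
   Context: A simple directed graph (digraph) has no loops and at most one edge from $u$ to $v$ for each ordered pair of distinct vertices $(u,v)$; both $uv$ and $vu$ may be edges, where $uv$ denotes the edge directed from $u$ to $v$. The random walk on $G$ moves at each step from its current vertex to an out-neighbor of that vertex chosen uniformly at random, independently of the past. A random cover tour from $u$ is this random walk started at $u$ (the starting vertex $u$ counts as visited) and stopped at the first time it has visited every vertex of $G$; in a finite strongly connected digraph it terminates almost surely. $L(u,v)$ denotes the event that the random cover tour from $u$ ends at $v$, i.e. that $v$ is the last vertex to be visited for the first time. -}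

module Defs where

open import Data.Bool using (if_then_else_)
open import Data.Fin using (Fin; _≤_; _<_)
open import Data.Fin.Properties using (any?; all?; _≟_; _≤?_; _<?_)
import Data.Integer as ℤ
open import Data.List using (List; []; _∷_; map; foldr; filter; length; allFin)
open import Data.Nat as ℕ using (ℕ; zero; suc)
open import Data.Product using (_×_; ∃-syntax)
open import Data.Rational as ℚ using (ℚ; 0ℚ; 1ℚ; _/_; _-_; ∣_∣)
open import Data.Vec using (Vec; []; _∷_; lookup)
open import Level using (0ℓ)
open import Relation.Binary using (Rel; Irreflexive; Decidable)
open import Relation.Binary.Construct.Closure.ReflexiveTransitive using (Star)
open import Relation.Binary.PropositionalEquality using (_≡_)
open import Relation.Nullary using (¬_; ¬?; does; _×-dec_; _→-dec_)
import Relation.Unary as U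

record SimpleDigraph (n : ℕ) : Set₁ where
  field
    _⟶_    : Rel (Fin n) 0ℓ
    _⟶?_   : Decidable _⟶_
    irrefl : Irreflexive _≡_ _⟶_

  outNeighbours : Fin n → List (Fin n)
  outNeighbours u = filter (u ⟶?_) (allFin n)

  StronglyConnected : Set
  StronglyConnected = ∀ u v → Star _⟶_ u v

-- The value at [] is a convention.  In a strongly connected digraph it is
-- reached only from the vertex of the one-vertex graph.
mean : List ℚ → ℚ
mean []          = 0ℚ
mean xs@(_ ∷ _)  = (ℤ.+ 1 / length xs) ℚ.* foldr ℚ._+_ 0ℚ xs

module _ {n t : ℕ} (ω : Vec (Fin n) (suc t)) where

  CoveredBy : Fin (suc t) → Set
  CoveredBy s = ∀ v → ∃[ i ] i ≤ s × lookup ω i ≡ v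

  CoverTime : Fin (suc t) → Set
  CoverTime τ = CoveredBy τ × (∀ s → s < τ → ¬ CoveredBy s)

  CoverTourEndsAt : Fin n → Set
  CoverTourEndsAt v = ∃[ τ ] CoverTime τ × lookup ω τ ≡ v

  coveredBy? : U.Decidable CoveredBy
  coveredBy? s = all? λ v → any? λ i → (i ≤? s) ×-dec (lookup ω i ≟ v)

  coverTime? : U.Decidable CoverTime
  coverTime? τ = coveredBy? τ ×-dec all? λ s → (s <? τ) →-dec ¬? (coveredBy? s)

  coverTourEndsAt? : U.Decidable CoverTourEndsAt
  coverTourEndsAt? v = any? λ τ → coverTime? τ ×-dec (lookup ω τ ≟ v)

module RandomWalk {n : ℕ} (G : SimpleDigraph n) where
  open SimpleDigraph G

  -- Expectation of f (X₀, …, Xₜ), where X is the random walk started at u.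
  𝔼 : (t : ℕ) → Fin n → (Vec (Fin n) (suc t) → ℚ) → ℚ
  𝔼 zero    u f = f (u ∷ [])
  𝔼 (suc t) u f = mean (map (λ w → 𝔼 t w (λ ω → f (u ∷ ω))) (outNeighbours u))

  ℙ : (t : ℕ) → Fin n → {A : U.Pred (Vec (Fin n) (suc t)) 0ℓ} → U.Decidable A → ℚ
  ℙ t u A? = 𝔼 t u (λ ω → if does (A? ω) then 1ℚ else 0ℚ)

  -- The real number ℙ(L(u,v)), presented by rational approximations: the t-th
  -- one is the probability that the cover tour from u has stopped by time t and
  -- has ended at v.  These events increase to L(u,v), so the sequence is
  -- nondecreasing, bounded by 1, and has limit ℙ(L(u,v)).
  ℙL : Fin n → Fin n → ℕ → ℚ
  ℙL u v t = ℙ t u (λ ω → coverTourEndsAt? ω v)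

-- Equality of the real numbers presented by two convergent sequences.
_≃_ : Rel (ℕ → ℚ) 0ℓ
a ≃ b = ∀ ε → 0ℚ ℚ.< ε → ∃[ N ] ∀ t → N ℕ.≤ t → ∣ a t - b t ∣ ℚ.< ε

{-# OPTIONS --safe #-}

-- Almost surely the tour covers G, so the hypothesis makes every ℙ(L(u,v)) with u ≠ v
-- equal to p = 1/(n-1).  Condition on the first step u → w of a tour from u.  The tour
-- from w with u already visited ends at z either if the plain tour from w does, or if
-- the plain tour from w ends by visiting z second last and u last.  Hence, writing
-- e(w) for the probability of the latter event,
--   p = mean over w ∈ N(u) of ([w ≠ z] p + e(w)).
-- If u ↛ z this forces e = 0 on N(u); if u → z it forces e(w) > 0 for some w ∈ N(u).
-- Now let u → v and v ↛ u.  The second case (with z = v) yields a walk from some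
-- w ∈ N(u) that covers all vertices but u and v, avoiding both, before it reaches v.
-- As p > 0, every G - x is strongly connected.  So v is joined to w by a walk avoiding
-- u, and from its last visit to v on this walk also avoids v; the end of the covering
-- walk can be led to u instead of v.  The result is a walk from an out-neighbour of v
-- that visits u second last and v last, contradicting the first case for v ↛ u.
module Submission where

import Algebra.Properties.CommutativeMonoid.Sum as CommutativeMonoidSum
open import Data.Bool using (if_then_else_; true; false)
open import Data.Fin as Fin using (Fin; zero; suc)
import Data.Fin.Properties as Fin
import Data.Integer as ℤ
import Data.Integer.Properties as ℤ
open import Data.List using (List; []; _∷_; _++_; map; foldr; length; allFin)
open import Data.List.Properties using (length-map; length-filter; length-tabulate)
import Data.List.Membership.DecPropositional as DecMembership
open import Data.List.Membership.Propositional using (_∈_; _∉_)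
open import Data.List.Membership.Propositional.Properties
  using (∈-filter⁺; ∈-filter⁻; ∈-allFin; ∈-++⁺ʳ; ∈-++⁻)
open import Data.List.Relation.Unary.Any using (here; there)
open import Data.Nat as ℕ using (ℕ; zero; suc; z≤n; s≤s)
import Data.Nat.Properties as ℕ
open import Data.Product using (_×_; _,_; ∃-syntax; proj₁; proj₂)
open import Data.Rational as ℚ
  using (ℚ; 0ℚ; 1ℚ; ½; _/_; _+_; _*_; _-_; -_; _≤_; _<_; ∣_∣; toℚᵘ)
open import Data.Rational.Properties
open import Data.Rational.Solver using (module +-*-Solver)
open import Data.Rational.Unnormalised as ℚᵘ using (mkℚᵘ; *≡*)
import Data.Rational.Unnormalised.Properties as ℚᵘ
open import Data.Sum using (_⊎_; inj₁; inj₂; [_,_])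
open import Data.Vec using (Vec; []; _∷_; lookup)
open import Function using (_∘_; _$_; _⇔_; mk⇔; Equivalence)
open import Relation.Binary using (tri<; tri≈; tri>)
open import Relation.Binary.Construct.Closure.ReflexiveTransitive using (Star; _◅_) renaming (ε to ε★)
open import Relation.Binary.PropositionalEquality
  using (_≡_; _≢_; refl; sym; trans; cong; cong₂; subst; subst₂; module ≡-Reasoning)
open import Relation.Nullary using (¬_; Dec; yes; no; does; contradiction; ¬?; _×-dec_; _⊎-dec_)
open import Relation.Nullary.Decidable using (dec-true; dec-false; does-⇔; decidable-stable)
open import Defs

open CommutativeMonoidSum +-0-commutativeMonoid using (sum; sum-remove; ∑-distrib-+)
open +-*-Solver using (solve; _:=_; _:+_; _:*_; _:-_; :-_; con)

-- Arithmetic and order of the rationals.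

-- The operations of ℚ unfold eagerly; opacity keeps terms built from nat and inv small.
opaque

  nat : ℕ → ℚ
  nat k = ℤ.+ k / 1

  inv : ℕ → ℚ
  inv zero    = 0ℚ
  inv (suc k) = ℤ.+ 1 / suc k

  nat-zero : nat zero ≡ 0ℚ
  nat-zero = refl

  nat-suc : ∀ k → nat (suc k) ≡ 1ℚ + nat k
  nat-suc k = toℚᵘ-injective $ begin-equality
    toℚᵘ (nat (suc k))          ≃⟨ toℚᵘ-fromℚᵘ (mkℚᵘ (ℤ.+ suc k) 0) ⟩
    mkℚᵘ (ℤ.+ suc k) 0          ≃⟨ *≡* (cong (λ i → (ℤ.+ 1 ℤ.+ i) ℤ.* ℤ.+ 1) (sym (ℤ.*-identityʳ (ℤ.+ k)))) ⟩
    ℚᵘ.1ℚᵘ ℚᵘ.+ mkℚᵘ (ℤ.+ k) 0  ≃⟨ ℚᵘ.+-congʳ ℚᵘ.1ℚᵘ (ℚᵘ.≃-sym (toℚᵘ-fromℚᵘ (mkℚᵘ (ℤ.+ k) 0))) ⟩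
    toℚᵘ 1ℚ ℚᵘ.+ toℚᵘ (nat k)   ≃⟨ ℚᵘ.≃-sym (toℚᵘ-homo-+ 1ℚ (nat k)) ⟩
    toℚᵘ (1ℚ + nat k)           ∎
    where open ℚᵘ.≤-Reasoning

  inv*nat : ∀ k → inv (suc k) * nat (suc k) ≡ 1ℚ
  inv*nat k = toℚᵘ-injective $ begin-equality
    toℚᵘ (inv (suc k) * nat (suc k))             ≃⟨ toℚᵘ-homo-* (inv (suc k)) (nat (suc k)) ⟩
    toℚᵘ (inv (suc k)) ℚᵘ.* toℚᵘ (nat (suc k))   ≃⟨ ℚᵘ.*-cong (toℚᵘ-fromℚᵘ (mkℚᵘ (ℤ.+ 1) k))
                                                              (toℚᵘ-fromℚᵘ (mkℚᵘ (ℤ.+ suc k) 0)) ⟩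
    mkℚᵘ (ℤ.+ 1) k ℚᵘ.* mkℚᵘ (ℤ.+ suc k) 0       ≃⟨ *≡* cross-multiplied ⟩
    ℚᵘ.1ℚᵘ                                       ∎
    where
    open ℚᵘ.≤-Reasoning
    cross-multiplied : (ℤ.+ 1 ℤ.* ℤ.+ suc k) ℤ.* ℤ.+ 1 ≡ ℤ.+ 1 ℤ.* ℤ.+ (suc k ℕ.* 1)
    cross-multiplied = trans (ℤ.*-identityʳ _)
      (cong (λ j → ℤ.+ 1 ℤ.* ℤ.+ suc j) (sym (ℕ.*-identityʳ k)))

  0<inv : ∀ k → 0ℚ < inv (suc k)
  0<inv k = positive⁻¹ (inv (suc k)) {{normalize-pos 1 (suc k)}}

  inv-zero : inv zero ≡ 0ℚ
  inv-zero = refl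

  inv-one : inv 1 ≡ 1ℚ
  inv-one = refl

  inv-denominator≤ : ∀ p → 0ℚ < p → inv (ℚ.↧ₙ p) ≤ p
  inv-denominator≤ p 0<p with p | ℚ.positive 0<p
  ... | ℚ.mkℚ (ℤ.+ suc a) d c | _ =
    toℚᵘ-cancel-≤ (ℚᵘ.≤-respˡ-≃ (ℚᵘ.≃-sym (toℚᵘ-fromℚᵘ (mkℚᵘ (ℤ.+ 1) d)))
      (ℚᵘ.*≤* (ℤ.*-monoʳ-≤-nonNeg (ℤ.+ suc d) {ℤ.+ 1} {ℤ.+ suc a} (ℤ.+≤+ (s≤s z≤n)))))

  mean≡inv*sum : ∀ xs → mean xs ≡ inv (length xs) * foldr _+_ 0ℚ xs
  mean≡inv*sum []      = refl
  mean≡inv*sum (_ ∷ _) = refl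

*-monoˡ-≤ : ∀ {r p q} → 0ℚ ≤ r → p ≤ q → r * p ≤ r * q
*-monoˡ-≤ {r} 0≤r = *-monoˡ-≤-nonNeg r {{ℚ.nonNegative 0≤r}}

*-monoˡ-< : ∀ {r p q} → 0ℚ < r → p < q → r * p < r * q
*-monoˡ-< {r} 0<r = *-monoʳ-<-pos r {{ℚ.positive 0<r}}

0≤* : ∀ {p q} → 0ℚ ≤ p → 0ℚ ≤ q → 0ℚ ≤ p * q
0≤* {p} {q} 0≤p 0≤q = subst (_≤ p * q) (*-zeroʳ p) (*-monoˡ-≤ 0≤p 0≤q)

0<* : ∀ {p q} → 0ℚ < p → 0ℚ < q → 0ℚ < p * q
0<* {p} {q} 0<p 0<q = subst (_< p * q) (*-zeroʳ p) (*-monoˡ-< 0<p 0<q)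

p≤p+q : ∀ {p q} → 0ℚ ≤ q → p ≤ p + q
p≤p+q {p} {q} 0≤q = subst (_≤ p + q) (+-identityʳ p) (+-monoʳ-≤ p 0≤q)

0<1 : 0ℚ < 1ℚ
0<1 = positive⁻¹ 1ℚ

0<½ : 0ℚ < ½
0<½ = positive⁻¹ ½

halves : ∀ p → ½ * p + ½ * p ≡ p
halves = solve 1 (λ p → con ½ :* p :+ con ½ :* p := p) refl

nat-mono : ∀ {j k} → j ℕ.≤ k → nat j ≤ nat k
nat-mono {k = zero} z≤n = ≤-refl
nat-mono {k = suc k} z≤n = begin
  nat 0       ≤⟨ nat-mono {0} {k} z≤n ⟩
  nat k       ≤⟨ p≤p+q (<⇒≤ 0<1) ⟩
  nat k + 1ℚ  ≡⟨ +-comm (nat k) 1ℚ ⟩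
  1ℚ + nat k  ≡⟨ nat-suc k ⟨
  nat (suc k) ∎
  where open ≤-Reasoning
nat-mono {suc j} {suc k} (s≤s j≤k) =
  subst₂ _≤_ (sym (nat-suc j)) (sym (nat-suc k)) (+-monoʳ-≤ 1ℚ (nat-mono j≤k))

0≤nat : ∀ k → 0ℚ ≤ nat k
0≤nat k = ≤-trans (≤-reflexive (sym nat-zero)) (nat-mono {0} {k} z≤n)

inv-antitone : ∀ {j k} → suc j ℕ.≤ suc k → inv (suc k) ≤ inv (suc j)
inv-antitone {j} {k} j≤k = begin
  inv (suc k)                                ≡⟨ *-identityʳ _ ⟨
  inv (suc k) * 1ℚ                           ≡⟨ cong (inv (suc k) *_) (inv*nat j) ⟨
  inv (suc k) * (inv (suc j) * nat (suc j))  ≤⟨ *-monoˡ-≤ (<⇒≤ (0<inv k)) (*-monoˡ-≤ (<⇒≤ (0<inv j)) (nat-mono j≤k)) ⟩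
  inv (suc k) * (inv (suc j) * nat (suc k))  ≡⟨ solve 3 (λ a b c → a :* (b :* c) := b :* (a :* c)) refl
                                                  (inv (suc k)) (inv (suc j)) (nat (suc k)) ⟩
  inv (suc j) * (inv (suc k) * nat (suc k))  ≡⟨ cong (inv (suc j) *_) (inv*nat k) ⟩
  inv (suc j) * 1ℚ                           ≡⟨ *-identityʳ _ ⟩
  inv (suc j)                                ∎
  where open ≤-Reasoning

-- The denominator of `x` serves as `j`, since a positive fraction is at least the inverse of its
-- denominator.
archimedean : ∀ x → 0ℚ < x → ∃[ j ] 1ℚ ≤ nat j * x
archimedean x 0<x = d , (begin
  1ℚ             ≡⟨ inv*nat (ℚ.ℚ.denominator-1 x) ⟨
  inv d * nat d  ≡⟨ *-comm (inv d) (nat d) ⟩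
  nat d * inv d  ≤⟨ *-monoˡ-≤ (0≤nat d) (inv-denominator≤ x 0<x) ⟩
  nat d * x      ∎)
  where
  open ≤-Reasoning
  d : ℕ
  d = ℚ.↧ₙ x

inv≤1 : ∀ n → inv n ≤ 1ℚ
inv≤1 zero    = ≤-trans (≤-reflexive inv-zero) (<⇒≤ 0<1)
inv≤1 (suc k) = ≤-trans (inv-antitone {0} {k} (s≤s z≤n)) (≤-reflexive inv-one)

0<inv-size : ∀ {n} → Fin n → 0ℚ < inv n
0<inv-size {suc m} _ = 0<inv m

inv*nat-size : ∀ {n} → Fin n → inv n * nat n ≡ 1ℚ
inv*nat-size {suc k} _ = inv*nat k

-- Finite sums indexed by `Fin n`.

Σ-const : ∀ {n} (f : Fin n → ℚ) {c} → (∀ i → f i ≡ c) → sum f ≡ nat n * c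
Σ-const {zero}  f {c} eq = sym (trans (cong (_* c) nat-zero) (*-zeroˡ c))
Σ-const {suc n} f {c} eq = trans (cong₂ _+_ (eq zero) (Σ-const (f ∘ suc) (eq ∘ suc)))
  (trans (solve 2 (λ c m → c :+ m :* c := (con 1ℚ :+ m) :* c) refl c (nat n)) (cong (_* c) (sym (nat-suc n))))

Σ-mono : ∀ {n} {f g : Fin n → ℚ} → (∀ i → f i ≤ g i) → sum f ≤ sum g
Σ-mono {zero}  f≤g = ≤-refl
Σ-mono {suc n} f≤g = +-mono-≤ (f≤g zero) (Σ-mono (f≤g ∘ suc))

Σ-≤-const : ∀ {n} {f : Fin n → ℚ} {c} → (∀ i → f i ≤ c) → sum f ≤ nat n * c
Σ-≤-const {n} {c = c} f≤c = ≤-trans (Σ-mono f≤c) (≤-reflexive (Σ-const {n} (λ _ → c) λ _ → refl))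

Σ-≥-const : ∀ {n} {f : Fin n → ℚ} {c} → (∀ i → c ≤ f i) → nat n * c ≤ sum f
Σ-≥-const {n} {c = c} c≤f = ≤-trans (≤-reflexive (sym (Σ-const {n} (λ _ → c) λ _ → refl))) (Σ-mono c≤f)

-- A slack known at one vertex survives termwise comparison; this drives the union bound over
-- vertices.
Σ-bump : ∀ {n} {f g : Fin n → ℚ} → (∀ i → f i ≤ g i) → ∀ i {δ} → f i + δ ≤ g i → sum f + δ ≤ sum g
Σ-bump {f = f} f≤g zero {δ} b = ≤-trans
  (≤-reflexive (solve 3 (λ a s d → a :+ s :+ d := a :+ d :+ s) refl (f zero) (sum (f ∘ suc)) δ))
  (+-mono-≤ b (Σ-mono (f≤g ∘ suc)))
Σ-bump {f = f} f≤g (suc i) {δ} b = ≤-trans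
  (≤-reflexive (+-assoc (f zero) (sum (f ∘ suc)) δ))
  (+-mono-≤ (f≤g zero) (Σ-bump (f≤g ∘ suc) i b))

Σ≤term : ∀ {n} {f : Fin n → ℚ} i → (∀ j → j ≢ i → f j ≤ 0ℚ) → sum f ≤ f i
Σ≤term {f = f} zero    h =
  ≤-trans (+-monoʳ-≤ (f zero) (Σ≤0 (λ j → h (suc j) λ ()))) (≤-reflexive (+-identityʳ _))
  where
  Σ≤0 : ∀ {m} {g : Fin m → ℚ} → (∀ j → g j ≤ 0ℚ) → sum g ≤ 0ℚ
  Σ≤0 {zero}  g≤0 = ≤-refl
  Σ≤0 {suc m} g≤0 = +-mono-≤ (g≤0 zero) (Σ≤0 (g≤0 ∘ suc))
Σ≤term {f = f} (suc i) h =
  ≤-trans (+-mono-≤ (h zero λ ()) (Σ≤term i (λ j j≢i → h (suc j) λ { refl → j≢i refl })))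
    (≤-reflexive (+-identityˡ _))

-- Sums and means over lists.

module _ {A : Set} where

  total : (A → ℚ) → List A → ℚ
  total f xs = foldr _+_ 0ℚ (map f xs)

  mean≡inv*total : ∀ f xs → mean (map f xs) ≡ inv (length xs) * total f xs
  mean≡inv*total f xs =
    trans (mean≡inv*sum (map f xs)) (cong (λ l → inv l * total f xs) (length-map f xs))

  total-≥ : ∀ f xs {a} → (∀ {y} → y ∈ xs → a ≤ f y) → nat (length xs) * a ≤ total f xs
  total-≥ f []       {a} h = ≤-reflexive (trans (cong (_* a) nat-zero) (*-zeroˡ a))
  total-≥ f (x ∷ xs) {a} h = ≤-trans (≤-reflexive (trans (cong (_* a) (nat-suc (length xs)))
      (solve 2 (λ a m → (con 1ℚ :+ m) :* a := a :+ m :* a) refl a (nat (length xs)))))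
    (+-mono-≤ (h (here refl)) (total-≥ f xs (h ∘ there)))

  total-bump : ∀ f xs {a δ x} → (∀ {y} → y ∈ xs → a ≤ f y) → x ∈ xs → a + δ ≤ f x →
               nat (length xs) * a + δ ≤ total f xs
  total-bump f (x ∷ xs) {a} {δ} h x∈ b =
    ≤-trans (≤-reflexive (trans (cong (λ z → z * a + δ) (nat-suc (length xs)))
      (solve 3 (λ a m δ → (con 1ℚ :+ m) :* a :+ δ := (a :+ δ) :+ m :* a) refl a (nat (length xs)) δ)))
      (step x∈)
    where
    step : _ ∈ x ∷ xs → (a + δ) + nat (length xs) * a ≤ f x + total f xs
    step (here refl) = +-mono-≤ b (total-≥ f xs (h ∘ there))
    step (there y∈)  = ≤-trans
      (≤-reflexive (solve 3 (λ a d m → a :+ d :+ m := a :+ (m :+ d)) refl a δ (nat (length xs) * a)))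
      (+-mono-≤ (h (here refl)) (total-bump f xs (h ∘ there) y∈ b))

  -- Raising one entry by `δ` raises the mean by `δ` divided by the length. The bound divides by the
  -- larger `n` instead, so that one factor serves at every vertex.
  mean-bump : ∀ f xs {n a δ x} → length xs ℕ.≤ n → 0ℚ ≤ δ → (∀ {y} → y ∈ xs → a ≤ f y) →
              x ∈ xs → a + δ ≤ f x → a + inv n * δ ≤ mean (map f xs)
  mean-bump f xs@(_ ∷ xs′) {suc n} {a} {δ} l≤n 0≤δ h x∈ b = begin
    a + inv (suc n) * δ            ≤⟨ +-monoʳ-≤ a (*-monoʳ-≤-nonNeg δ {{ℚ.nonNegative 0≤δ}} (inv-antitone l≤n)) ⟩
    a + inv l * δ                  ≡⟨ cong (_+ inv l * δ) (trans (cong (_* a) (inv*nat (length xs′))) (*-identityˡ a)) ⟨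
    inv l * nat l * a + inv l * δ  ≡⟨ solve 4 (λ i m a d → i :* m :* a :+ i :* d := i :* (m :* a :+ d)) refl
                                        (inv l) (nat l) a δ ⟩
    inv l * (nat l * a + δ)        ≤⟨ *-monoˡ-≤ (<⇒≤ (0<inv (length xs′))) (total-bump f xs h x∈ b) ⟩
    inv l * total f xs             ≡⟨ mean≡inv*total f xs ⟨
    mean (map f xs)                ∎
    where
    open ≤-Reasoning
    l : ℕ
    l = length xs

  mean-+ : ∀ f g xs → mean (map (λ x → f x + g x) xs) ≡ mean (map f xs) + mean (map g xs)
  mean-+ f g xs = begin
    mean (map (λ x → f x + g x) xs)      ≡⟨ mean≡inv*total _ xs ⟩
    i * total (λ x → f x + g x) xs       ≡⟨ cong (i *_) (total-+ xs) ⟩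
    i * (total f xs + total g xs)        ≡⟨ *-distribˡ-+ i (total f xs) (total g xs) ⟩
    i * total f xs + i * total g xs      ≡⟨ cong₂ _+_ (mean≡inv*total f xs) (mean≡inv*total g xs) ⟨
    mean (map f xs) + mean (map g xs)    ∎
    where
    open ≡-Reasoning
    i : ℚ
    i = inv (length xs)
    total-+ : ∀ xs → total (λ x → f x + g x) xs ≡ total f xs + total g xs
    total-+ []       = refl
    total-+ (x ∷ xs) = trans (cong (f x + g x +_) (total-+ xs))
      (solve 4 (λ a b c d → a :+ b :+ (c :+ d) := (a :+ c) :+ (b :+ d)) refl (f x) (g x) (total f xs) (total g xs))

  mean-mono : ∀ {f g} xs → (∀ {y} → y ∈ xs → f y ≤ g y) → mean (map f xs) ≤ mean (map g xs)
  mean-mono {f} {g} []          h = ≤-refl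
  mean-mono {f} {g} xs@(_ ∷ ys) h = ≤-trans (≤-reflexive (mean≡inv*total f xs))
    (≤-trans (*-monoˡ-≤ (<⇒≤ (0<inv (length ys))) (total-mono xs h)) (≤-reflexive (sym (mean≡inv*total g xs))))
    where
    total-mono : ∀ xs → (∀ {y} → y ∈ xs → f y ≤ g y) → total f xs ≤ total g xs
    total-mono []       h = ≤-refl
    total-mono (x ∷ xs) h = +-mono-≤ (h (here refl)) (total-mono xs (h ∘ there))

  mean-cong : ∀ {f g} xs → (∀ {y} → y ∈ xs → f y ≡ g y) → mean (map f xs) ≡ mean (map g xs)
  mean-cong xs f≡g =
    ≤-antisym (mean-mono xs (≤-reflexive ∘ f≡g)) (mean-mono xs (≤-reflexive ∘ sym ∘ f≡g))

  -- Membership of some `x` excludes the empty list, whose mean is 0 by convention.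
  mean-const : ∀ {x} xs → x ∈ xs → ∀ c → mean (map (λ _ → c) xs) ≡ c
  mean-const xs@(_ ∷ ys) _ c = trans (mean≡inv*total _ xs)
    (trans (cong (inv (length xs) *_) (total-const xs))
      (trans (sym (*-assoc (inv (length xs)) (nat (length xs)) c))
        (trans (cong (_* c) (inv*nat (length ys))) (*-identityˡ c))))
    where
    total-const : ∀ xs → total (λ _ → c) xs ≡ nat (length xs) * c
    total-const []       = sym (trans (cong (_* c) nat-zero) (*-zeroˡ c))
    total-const (x ∷ xs) = trans (cong (c +_) (total-const xs))
      (trans (solve 2 (λ c m → c :+ m :* c := (con 1ℚ :+ m) :* c) refl c (nat (length xs)))
        (cong (_* c) (sym (nat-suc (length xs)))))

  mean≢0⇒∃ : ∀ f xs → mean (map f xs) ≢ 0ℚ → ∃[ x ] x ∈ xs × f x ≢ 0ℚ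
  mean≢0⇒∃ f xs m≢0 = total≢0 xs λ t≡0 → m≢0
    (trans (mean≡inv*total f xs) (trans (cong (inv (length xs) *_) t≡0) (*-zeroʳ (inv (length xs)))))
    where
    total≢0 : ∀ xs → total f xs ≢ 0ℚ → ∃[ x ] x ∈ xs × f x ≢ 0ℚ
    total≢0 []       t≢0 = contradiction refl t≢0
    total≢0 (x ∷ xs) t≢0 with f x ≟ 0ℚ
    ... | no  fx≢0 = x , here refl , fx≢0
    ... | yes fx≡0 with total≢0 xs (λ t≡0 → t≢0 (cong₂ _+_ fx≡0 t≡0))
    ...   | y , y∈ , fy≢0 = y , there y∈ , fy≢0

-- The walk up to its first visit of a vertex

𝟙 : ∀ {A : Set} → Dec A → ℚ
𝟙 A? = if does A? then 1ℚ else 0ℚ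

𝟙-true : ∀ {A : Set} (A? : Dec A) → A → 𝟙 A? ≡ 1ℚ
𝟙-true A? a rewrite dec-true A? a = refl

𝟙-false : ∀ {A : Set} (A? : Dec A) → ¬ A → 𝟙 A? ≡ 0ℚ
𝟙-false A? ¬a rewrite dec-false A? ¬a = refl

0≤𝟙 : ∀ {A : Set} (A? : Dec A) → 0ℚ ≤ 𝟙 A?
0≤𝟙 (yes _) = <⇒≤ 0<1
0≤𝟙 (no  _) = ≤-refl

𝟙≤1 : ∀ {A : Set} (A? : Dec A) → 𝟙 A? ≤ 1ℚ
𝟙≤1 (yes _) = ≤-refl
𝟙≤1 (no  _) = <⇒≤ 0<1

𝟙≢0 : ∀ {A : Set} (A? : Dec A) → 𝟙 A? ≢ 0ℚ → A
𝟙≢0 (yes a) _  = a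
𝟙≢0 (no  _) ≢0 = contradiction refl ≢0

𝟙-cong : ∀ {A B : Set} (A? : Dec A) (B? : Dec B) → (A → B) → (B → A) → 𝟙 A? ≡ 𝟙 B?
𝟙-cong A? B? f g = cong (if_then 1ℚ else 0ℚ) (does-⇔ (mk⇔ f g) A? B?)

module _ {n : ℕ} where

  open DecMembership (Fin._≟_ {n}) using (_∈?_)

  opaque

    -- φ evaluated at the part of ω before the first occurrence of z, and 0 if z does not occur.
    atHit : Fin n → (List (Fin n) → ℚ) → ∀ {m} → Vec (Fin n) m → ℚ
    atHit z φ []      = 0ℚ
    atHit z φ (x ∷ ω) = if does (x Fin.≟ z) then φ [] else atHit z (φ ∘ (x ∷_)) ω

    atHit-[] : ∀ z φ → atHit z φ [] ≡ 0ℚ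
    atHit-[] z φ = refl

    atHit-here : ∀ z φ {m} (ω : Vec (Fin n) m) → atHit z φ (z ∷ ω) ≡ φ []
    atHit-here z φ ω rewrite dec-true (z Fin.≟ z) refl = refl

    atHit-there : ∀ {x z} φ {m} (ω : Vec (Fin n) m) → x ≢ z →
                  atHit z φ (x ∷ ω) ≡ atHit z (φ ∘ (x ∷_)) ω
    atHit-there {x} {z} φ ω x≢z rewrite dec-false (x Fin.≟ z) x≢z = refl

    atHit-nonNeg : ∀ z {φ} → (∀ l → 0ℚ ≤ φ l) → ∀ {m} (ω : Vec (Fin n) m) → 0ℚ ≤ atHit z φ ω
    atHit-nonNeg z 0≤φ []      = ≤-refl
    atHit-nonNeg z 0≤φ (x ∷ ω) with does (x Fin.≟ z)
    ... | true  = 0≤φ []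
    ... | false = atHit-nonNeg z (0≤φ ∘ (x ∷_)) ω

    atHit-+ : ∀ z {φ ψ χ} → (∀ l → φ l ≡ ψ l + χ l) → ∀ {m} (ω : Vec (Fin n) m) →
              atHit z φ ω ≡ atHit z ψ ω + atHit z χ ω
    atHit-+ z φ≡ψ+χ []      = refl
    atHit-+ z φ≡ψ+χ (x ∷ ω) with does (x Fin.≟ z)
    ... | true  = φ≡ψ+χ []
    ... | false = atHit-+ z (φ≡ψ+χ ∘ (x ∷_)) ω

  Covers : Fin n → List (Fin n) → Set
  Covers z l = ∀ x → x ≡ z ⊎ x ∈ l

  covers? : ∀ z l → Dec (Covers z l)
  covers? z l = Fin.all? λ x → (x Fin.≟ z) ⊎-dec (x ∈? l)

  -- If `l` is the part of a walk before its first visit of `z`, this says that `z` is visited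
  -- second last and `u` last.
  CoversAvoiding : Fin n → Fin n → List (Fin n) → Set
  CoversAvoiding u z l = Covers z (u ∷ l) × u ∉ l

  coversAvoiding? : ∀ u z l → Dec (CoversAvoiding u z l)
  coversAvoiding? u z l = covers? z (u ∷ l) ×-dec ¬? (u ∈? l)

  -- If `u` lies on `l`, prepending it changes nothing and the second term is 0. Otherwise `l` alone
  -- misses `u`, which differs from `z`, and the first term is 0.
  covers-split : ∀ {u z} → u ≢ z → ∀ l →
    𝟙 (covers? z (u ∷ l)) ≡ 𝟙 (covers? z l) + 𝟙 (coversAvoiding? u z l)
  covers-split {u} {z} u≢z l with u ∈? l
  ... | yes u∈l = trans
    (𝟙-cong (covers? z (u ∷ l)) (covers? z l)
      (λ c x → [ inj₁ , (λ { (here refl) → inj₂ u∈l ; (there x∈l) → inj₂ x∈l }) ] (c x))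
      (λ c x → [ inj₁ , inj₂ ∘ there ] (c x)))
    (trans (sym (+-identityʳ (𝟙 (covers? z l))))
      (cong (𝟙 (covers? z l) +_)
        -- The `with` has also replaced the decision inside `coversAvoiding? u z l`, hence its
        -- unfolded form.
        (sym (𝟙-false (covers? z (u ∷ l) ×-dec no (contradiction u∈l)) (λ c → proj₂ c u∈l)))))
  ... | no  u∉l = trans
    (𝟙-cong (covers? z (u ∷ l)) (covers? z (u ∷ l) ×-dec yes u∉l) (_, u∉l) proj₁)
    (trans (sym (+-identityˡ (𝟙 (covers? z (u ∷ l) ×-dec yes u∉l))))
      (cong (_+ 𝟙 (covers? z (u ∷ l) ×-dec yes u∉l))
        (sym (𝟙-false (covers? z l) λ c → [ u≢z , u∉l ] (c u)))))

  -- `sound` and `full` together say that `prefix` has exactly the vertices seen before `time`.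
  -- `value` ranges over all weights because passing a vertex `x` turns `φ` into `φ ∘ (x ∷_)`.
  record FirstHit (z : Fin n) {m} (ω : Vec (Fin n) m) : Set where
    field
      time   : Fin m
      prefix : List (Fin n)
      at     : lookup ω time ≡ z
      fresh  : z ∉ prefix
      sound  : ∀ {x} → x ∈ prefix → ∃[ j ] j Fin.< time × lookup ω j ≡ x
      full   : ∀ {j} → j Fin.< time → lookup ω j ∈ prefix
      value  : ∀ φ → atHit z φ ω ≡ φ prefix

  firstHit : ∀ z {m} (ω : Vec (Fin n) m) →
    FirstHit z ω ⊎ ((∀ i → lookup ω i ≢ z) × (∀ φ → atHit z φ ω ≡ 0ℚ))
  firstHit z []      = inj₂ ((λ ()) , atHit-[] z)
  firstHit z (x ∷ ω) with x Fin.≟ z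
  ... | yes refl = inj₁ record
    { time = zero ; prefix = [] ; at = refl ; fresh = λ () ; sound = λ () ; full = λ ()
    ; value = λ φ → atHit-here z φ ω }
  ... | no x≢z with firstHit z ω
  ...   | inj₂ (never , value) =
    inj₂ ( (λ { zero → x≢z ; (suc i) → never i })
         , λ φ → trans (atHit-there φ ω x≢z) (value (φ ∘ (x ∷_))))
  ...   | inj₁ hit = inj₁ record
    { time   = suc time
    ; prefix = x ∷ prefix
    ; at     = at
    ; fresh  = λ { (here z≡x) → x≢z (sym z≡x) ; (there z∈) → fresh z∈ }
    ; sound  = λ { (here refl) → zero , s≤s z≤n , refl
                 ; (there x∈)  → let (j , j< , eq) = sound x∈ in suc j , s≤s j< , eq }
    ; full   = λ { {zero} _ → here refl ; {suc j} (s≤s j<) → there (full j<) }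
    ; value  = λ φ → trans (atHit-there φ ω x≢z) (value (φ ∘ (x ∷_)))
    }
    where open FirstHit hit

  coversWeight : Fin n → List (Fin n) → ℚ
  coversWeight z l = 𝟙 (covers? z l)

  module _ {t : ℕ} (ω : Vec (Fin n) (suc t)) where

    -- The tour stops at a first visit, so whether it ends at `z` depends only on the vertices seen
    -- before the first visit of `z`.
    endsAt⇔covers : ∀ {z} (hit : FirstHit z ω) →
      CoverTourEndsAt ω z ⇔ Covers z (FirstHit.prefix hit)
    endsAt⇔covers {z} hit = mk⇔ to from
      where
      open FirstHit hit

      to : CoverTourEndsAt ω z → Covers z prefix
      to (τ , (covered , minimal) , ωτ≡z) x with covered x
      ... | j , j≤τ , ωj≡x with j Fin.≟ time
      ...   | yes refl = inj₁ (trans (sym ωj≡x) at)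
      ...   | no j≢i   = inj₂ (subst (_∈ prefix) ωj≡x (full (Fin.≤∧≢⇒< (ℕ.≤-trans j≤τ τ≤time) j≢i)))
        where
        τ≤time : τ Fin.≤ time
        -- Were `z` seen before `τ`, all vertices would be seen one step before `τ`: the vertex at
        -- `τ` is `z`, for which `time` already accounts. This contradicts minimality.
        τ≤time = ℕ.≮⇒≥ λ time<τ →
          minimal (Fin.pred τ) (Fin.pred< τ λ { refl → ℕ.n≮0 time<τ }) λ y → earlier time<τ y (covered y)
          where
          earlier : time Fin.< τ → ∀ y → ∃[ k ] k Fin.≤ τ × lookup ω k ≡ y →
                    ∃[ k ] k Fin.≤ Fin.pred τ × lookup ω k ≡ y
          earlier time<τ y (k , k≤τ , ωk≡y) with k Fin.≟ τ
          ... | yes refl = time , Fin.<⇒≤pred time<τ , trans at (trans (sym ωτ≡z) ωk≡y)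
          ... | no k≢τ   = k , Fin.<⇒≤pred (Fin.≤∧≢⇒< k≤τ k≢τ) , ωk≡y

      from : Covers z prefix → CoverTourEndsAt ω z
      from c = time , (covered , minimal) , at
        where
        covered : CoveredBy ω time
        covered x with c x
        ... | inj₁ x≡z = time , ℕ.≤-refl , trans at (sym x≡z)
        ... | inj₂ x∈  = let (j , j< , eq) = sound x∈ in j , ℕ.<⇒≤ j< , eq

        minimal : ∀ s → s Fin.< time → ¬ CoveredBy ω s
        minimal s s< cov with cov z
        ... | j , j≤s , ωj≡z = fresh (subst (_∈ prefix) ωj≡z (full (ℕ.≤-<-trans j≤s s<)))

    -- Turns the event into a weight on the prefix, which lets the walk be conditioned on its first
    -- step.
    endsAt≡atHit : ∀ z → 𝟙 (coverTourEndsAt? ω z) ≡ atHit z (coversWeight z) ω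
    endsAt≡atHit z with firstHit z ω
    ... | inj₂ (never , value) =
      trans (𝟙-false (coverTourEndsAt? ω z) λ (τ , _ , eq) → never τ eq) (sym (value (coversWeight z)))
    ... | inj₁ hit = trans
      (𝟙-cong (coverTourEndsAt? ω z) (covers? z (FirstHit.prefix hit)) (Equivalence.to e) (Equivalence.from e))
      (sym (FirstHit.value hit (coversWeight z)))
      where
      e : CoverTourEndsAt ω z ⇔ Covers z (FirstHit.prefix hit)
      e = endsAt⇔covers hit

    endsAt-unique : ∀ {v w} → CoverTourEndsAt ω v → CoverTourEndsAt ω w → v ≡ w
    endsAt-unique (τ , (cov , min) , refl) (τ′ , (cov′ , min′) , refl) with Fin.<-cmp τ τ′
    ... | tri< τ<τ′ _ _ = contradiction cov (min′ τ τ<τ′)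
    ... | tri≈ _ refl _ = refl
    ... | tri> _ _ τ′<τ = contradiction cov′ (min τ′ τ′<τ)

    allHit⇒endsAt : (∀ v → ∃[ i ] lookup ω i ≡ v) → ∃[ z ] CoverTourEndsAt ω z
    -- The search returns the least time that refutes being uncovered; decidability removes the
    -- double negation.
    allHit⇒endsAt hits with Fin.¬∀⟶∃¬-smallest (suc t)
      (λ s → ¬ CoveredBy ω s) (λ s → ¬? (coveredBy? ω s))
      (λ none → none (Fin.fromℕ t) λ v → let (i , eq) = hits v in i , Fin.≤fromℕ i , eq)
    ... | τ , ¬¬cov , before = lookup ω τ , τ , (decidable-stable (coveredBy? ω τ) ¬¬cov , minimal) , refl
      where
      minimal : ∀ s → s Fin.< τ → ¬ CoveredBy ω s
      minimal s s<τ = subst (λ s → ¬ CoveredBy ω s)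
        (Fin.toℕ-injective (trans (Fin.toℕ-inject (Fin.fromℕ< s<τ)) (Fin.toℕ-fromℕ< s<τ)))
        (before (Fin.fromℕ< s<τ))

    Σ-endsAt≤1 : sum (λ z → 𝟙 (coverTourEndsAt? ω z)) ≤ 1ℚ
    Σ-endsAt≤1 with Fin.any? (coverTourEndsAt? ω)
    ... | yes (z , e) = ≤-trans
      (Σ≤term z λ j j≢z → ≤-reflexive (𝟙-false (coverTourEndsAt? ω j) λ e′ → j≢z (endsAt-unique e′ e)))
      (𝟙≤1 (coverTourEndsAt? ω z))
    ... | no none = ≤-trans
      -- All terms vanish here, so any index serves.
      (Σ≤term (lookup ω zero) λ j _ → ≤-reflexive (𝟙-false (coverTourEndsAt? ω j) λ e → none (j , e)))
      (𝟙≤1 (coverTourEndsAt? ω (lookup ω zero)))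

    hit≤1 : ∀ z → atHit z (λ _ → 1ℚ) ω ≤ 1ℚ
    hit≤1 z with firstHit z ω
    ... | inj₁ hit         = ≤-reflexive (FirstHit.value hit _)
    ... | inj₂ (_ , value) = ≤-trans (≤-reflexive (value _)) (<⇒≤ 0<1)

    hit≤endsAt+1 : ∀ z → atHit z (λ _ → 1ℚ) ω ≤ 𝟙 (coverTourEndsAt? ω z) + 1ℚ
    hit≤endsAt+1 z = ≤-trans (hit≤1 z)
      (≤-trans (≤-reflexive (sym (+-identityˡ 1ℚ))) (+-monoˡ-≤ 1ℚ (0≤𝟙 (coverTourEndsAt? ω z))))

    -- Σ (1 - hit) + Σ endsAt ≥ 1, since either some vertex is not hit or the tour has ended;
    -- the shape avoids subtraction.
    Σ-hit≤Σ-endsAt : sum (λ z → atHit z (λ _ → 1ℚ) ω) + 1ℚ ≤ sum (λ z → 𝟙 (coverTourEndsAt? ω z) + 1ℚ)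
    Σ-hit≤Σ-endsAt with Fin.all? (λ z → Fin.any? λ i → lookup ω i Fin.≟ z)
    ... | yes hits = let (z , e) = allHit⇒endsAt hits in
      Σ-bump hit≤endsAt+1 z (≤-trans (+-monoˡ-≤ 1ℚ (hit≤1 z))
        (≤-reflexive (cong (_+ 1ℚ) (sym (𝟙-true (coverTourEndsAt? ω z) e)))))
    ... | no ¬hits with Fin.¬∀⟶∃¬ n _ (λ z → Fin.any? λ i → lookup ω i Fin.≟ z) ¬hits
    ...   | z , missed with firstHit z ω
    ...     | inj₁ hit         = contradiction (FirstHit.time hit , FirstHit.at hit) missed
    ...     | inj₂ (_ , value) = Σ-bump hit≤endsAt+1 z
      (+-monoˡ-≤ 1ℚ (≤-trans (≤-reflexive (value _)) (0≤𝟙 (coverTourEndsAt? ω z))))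

-- Limits

Eventually : (ℕ → Set) → Set
Eventually P = ∃[ N ] ∀ t → N ℕ.≤ t → P t

eventually-map : ∀ {P Q : ℕ → Set} → (∀ t → P t → Q t) → Eventually P → Eventually Q
eventually-map f (N , p) = N , λ t N≤t → f t (p t N≤t)

eventually-× : ∀ {P Q : ℕ → Set} → Eventually P → Eventually Q → Eventually (λ t → P t × Q t)
eventually-× (M , p) (N , q) = M ℕ.⊔ N , λ t ≤t →
  p t (ℕ.≤-trans (ℕ.m≤m⊔n M N) ≤t) , q t (ℕ.≤-trans (ℕ.m≤n⊔m M N) ≤t)

eventually-∀ : ∀ {k} {P : Fin k → ℕ → Set} → (∀ i → Eventually (P i)) → Eventually (λ t → ∀ i → P i t)
eventually-∀ {zero}  ev = 0 , λ t _ ()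
eventually-∀ {suc k} ev = eventually-map (λ t (p , ps) → λ { zero → p ; (suc i) → ps i })
  (eventually-× (ev zero) (eventually-∀ (ev ∘ suc)))

pow : ℚ → ℕ → ℚ
pow q zero    = 1ℚ
pow q (suc k) = q * pow q k

module _ {q : ℚ} (0≤q : 0ℚ ≤ q) (q≤1 : q ≤ 1ℚ) where

  0≤pow : ∀ k → 0ℚ ≤ pow q k
  0≤pow zero    = <⇒≤ 0<1
  0≤pow (suc k) = 0≤* 0≤q (0≤pow k)

  pow≤1 : ∀ k → pow q k ≤ 1ℚ
  pow≤1 zero    = ≤-refl
  pow≤1 (suc k) = ≤-trans (*-monoˡ-≤ 0≤q (pow≤1 k)) (≤-trans (≤-reflexive (*-identityʳ q)) q≤1)

0<pow : ∀ {q} → 0ℚ < q → ∀ k → 0ℚ < pow q k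
0<pow 0<q zero    = 0<1
0<pow 0<q (suc k) = 0<* 0<q (0<pow 0<q k)

p-q≤p : ∀ {p q} → 0ℚ ≤ q → p - q ≤ p
p-q≤p {p} {q} 0≤q = ≤-trans (p≤p+q 0≤q) (≤-reflexive (solve 2 (λ p q → p :- q :+ q := p) refl p q))

0≤q-p : ∀ {p q} → p ≤ q → 0ℚ ≤ q - p
0≤q-p {p} {q} p≤q = subst (_≤ q - p) (+-inverseʳ p) (+-monoˡ-≤ (- p) p≤q)

module _ {ε : ℚ} (0<ε : 0ℚ < ε) (ε≤1 : ε ≤ 1ℚ) where

  -- An elementary route to the decay of the geometric sequence: the left side at `suc j` is a
  -- convex combination, with weights `1ℚ - ε` and `ε`, of the left side at `j` and a power that is
  -- at most 1.
  j*ε*pow≤1 : ∀ j → nat j * ε * pow (1ℚ - ε) j ≤ 1ℚ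
  j*ε*pow≤1 zero    = ≤-trans (≤-reflexive (trans (cong (λ x → x * ε * 1ℚ) nat-zero)
    (trans (*-identityʳ (0ℚ * ε)) (*-zeroˡ ε)))) (<⇒≤ 0<1)
  j*ε*pow≤1 (suc j) = begin
    nat (suc j) * ε * M′                    ≡⟨ cong (λ x → x * ε * M′) (nat-suc j) ⟩
    (1ℚ + nat j) * ε * M′                   ≡⟨ solve 3 (λ j e m → (con 1ℚ :+ j) :* e :* ((con 1ℚ :- e) :* m)
                                                 := (con 1ℚ :- e) :* (j :* e :* m) :+ e :* ((con 1ℚ :- e) :* m))
                                                 refl (nat j) ε M ⟩
    (1ℚ - ε) * (nat j * ε * M) + ε * M′     ≤⟨ +-mono-≤ (*-monoˡ-≤ 0≤1-ε (j*ε*pow≤1 j))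
                                                 (*-monoˡ-≤ (<⇒≤ 0<ε) (pow≤1 0≤1-ε (p-q≤p (<⇒≤ 0<ε)) (suc j))) ⟩
    (1ℚ - ε) * 1ℚ + ε * 1ℚ                  ≡⟨ solve 1 (λ e → (con 1ℚ :- e) :* con 1ℚ :+ e :* con 1ℚ := con 1ℚ) refl ε ⟩
    1ℚ                                      ∎
    where
    open ≤-Reasoning
    M M′ : ℚ
    M = pow (1ℚ - ε) j
    M′ = pow (1ℚ - ε) (suc j)
    0≤1-ε : 0ℚ ≤ 1ℚ - ε
    0≤1-ε = 0≤q-p ε≤1

  pow-small : ∀ η → 0ℚ < η → ∃[ j ] pow (1ℚ - ε) j ≤ η
  pow-small η 0<η with archimedean (ε * η) (0<* 0<ε 0<η)
  ... | j , 1≤jεη = j , (begin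
    M                       ≡⟨ *-identityʳ M ⟨
    M * 1ℚ                  ≤⟨ *-monoˡ-≤ (0≤pow (0≤q-p ε≤1) (p-q≤p (<⇒≤ 0<ε)) j) 1≤jεη ⟩
    M * (nat j * (ε * η))   ≡⟨ solve 4 (λ m j e h → m :* (j :* (e :* h)) := h :* (j :* e :* m)) refl M (nat j) ε η ⟩
    η * (nat j * ε * M)     ≤⟨ *-monoˡ-≤ (<⇒≤ 0<η) (j*ε*pow≤1 j) ⟩
    η * 1ℚ                  ≡⟨ *-identityʳ η ⟩
    η                       ∎)
    where
    open ≤-Reasoning
    M : ℚ
    M = pow (1ℚ - ε) j

bounded : ∀ {k} (f : Fin k → ℕ) → ∃[ N ] ∀ i → f i ℕ.≤ N
bounded {zero}  f = 0 , λ ()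
bounded {suc k} f = let (N , b) = bounded (f ∘ suc) in
  f zero ℕ.⊔ N , λ { zero → ℕ.m≤m⊔n (f zero) N ; (suc i) → ℕ.≤-trans (b i) (ℕ.m≤n⊔m (f zero) N) }

-- Error estimates for the limit arguments.

p≤∣p∣ : ∀ p → p ≤ ∣ p ∣
p≤∣p∣ p with ≤-total 0ℚ p
... | inj₁ 0≤p = ≤-reflexive (sym (0≤p⇒∣p∣≡p 0≤p))
... | inj₂ p≤0 = ≤-trans p≤0 (0≤∣p∣ p)

p-q≤r⇒p≤q+r : ∀ {p q r} → p - q ≤ r → p ≤ q + r
p-q≤r⇒p≤q+r {p} {q} {r} h =
  ≤-trans (≤-reflexive (solve 2 (λ p q → p := q :+ (p :- q)) refl p q)) (+-monoʳ-≤ q h)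

∣p-q∣<r⇒p≤q+r : ∀ {p q r} → ∣ p - q ∣ < r → p ≤ q + r
∣p-q∣<r⇒p≤q+r {p} {q} h = p-q≤r⇒p≤q+r (≤-trans (p≤∣p∣ (p - q)) (<⇒≤ h))

∣p-q∣<r⇒q≤p+r : ∀ {p q r} → ∣ p - q ∣ < r → q ≤ p + r
∣p-q∣<r⇒q≤p+r {p} {q} {r} h = ∣p-q∣<r⇒p≤q+r (subst (_< r) ∣p-q∣≡∣q-p∣ h)
  where
  ∣p-q∣≡∣q-p∣ : ∣ p - q ∣ ≡ ∣ q - p ∣
  ∣p-q∣≡∣q-p∣ = trans (sym (∣-p∣≡∣p∣ (p - q))) (cong ∣_∣ (solve 2 (λ p q → :- (p :- q) := q :- p) refl p q))

half<self : ∀ {p} → 0ℚ < p → ½ * p < p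
half<self {p} 0<p = subst₂ _<_ (+-identityʳ (½ * p)) (halves p) (+-monoʳ-< (½ * p) (0<* 0<½ 0<p))

quarter : ℚ → ℚ
quarter p = ½ * (½ * p)

0<quarter : ∀ {p} → 0ℚ < p → 0ℚ < quarter p
0<quarter 0<p = 0<* 0<½ (0<* 0<½ 0<p)

p≰2quarters : ∀ {p} → 0ℚ < p → ¬ (p ≤ quarter p + quarter p)
p≰2quarters {p} 0<p p≤ =
  <-irrefl refl (≤-<-trans (≤-trans p≤ (≤-reflexive (halves (½ * p)))) (half<self 0<p))

-- Union bound. Read `h` as the sum of the probabilities of having hit each of the `n` vertices,
-- each at least `1ℚ - κ * ε`, and `s` as the probability that the tour has stopped.
coverage-bound : ∀ {n κ ε h s} → κ * n ≡ 1ℚ → n * (1ℚ - κ * ε) ≤ h → h + 1ℚ ≤ s + n → 1ℚ ≤ s + ε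
coverage-bound {n} {κ} {ε} {h} {s} κn≡1 ≤h h≤ = begin
  1ℚ                                       ≡⟨ solve 3 (λ n i e → con 1ℚ :=
                                                  (n :* (con 1ℚ :- i :* e) :+ con 1ℚ) :+ (i :* n :* e :- n)) refl n κ ε ⟩
  n * (1ℚ - κ * ε) + 1ℚ + (κ * n * ε - n)  ≡⟨ cong (λ x → n * (1ℚ - κ * ε) + 1ℚ + (x * ε - n)) κn≡1 ⟩
  n * (1ℚ - κ * ε) + 1ℚ + (1ℚ * ε - n)     ≤⟨ +-monoˡ-≤ (1ℚ * ε - n) (≤-trans (+-monoˡ-≤ 1ℚ ≤h) h≤) ⟩
  s + n + (1ℚ * ε - n)                     ≡⟨ solve 3 (λ s n e → s :+ n :+ (con 1ℚ :* e :- n) := s :+ e) refl s n ε ⟩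
  s + ε                                    ∎
  where open ≤-Reasoning

-- An excess `δ` over the lower bound for `a` must fit between `p - ε` and `p + ε`; `decrement≤`
-- treats a shortfall from the upper bound likewise.
increment≤ : ∀ {p ε δ a} → p - ε + δ ≤ a → a ≤ p + ε → δ ≤ ε + ε
increment≤ {p} {ε} {δ} {a} ≤a a≤ = begin
  δ                     ≡⟨ solve 3 (λ p e d → d := (p :- e :+ d) :+ (e :- p)) refl p ε δ ⟩
  p - ε + δ + (ε - p)   ≤⟨ +-monoˡ-≤ (ε - p) (≤-trans ≤a a≤) ⟩
  p + ε + (ε - p)       ≡⟨ solve 2 (λ p e → p :+ e :+ (e :- p) := e :+ e) refl p ε ⟩
  ε + ε                 ∎
  where open ≤-Reasoning

decrement≤ : ∀ {p ε a g} → g + a ≡ p + ε → p ≤ a + ε → g ≤ ε + ε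
decrement≤ {p} {ε} {a} {g} g+a≡ p≤ = begin
  g                 ≡⟨ solve 2 (λ g a → g := g :+ a :- a) refl g a ⟩
  g + a - a         ≡⟨ cong (_- a) g+a≡ ⟩
  p + ε - a         ≤⟨ +-monoˡ-≤ (- a) (+-monoˡ-≤ ε p≤) ⟩
  a + ε + ε - a     ≡⟨ solve 2 (λ a e → a :+ e :+ e :- a := e :+ e) refl a ε ⟩
  ε + ε             ∎
  where open ≤-Reasoning

q≤p+r⇒q-r≤p : ∀ {p q r} → q ≤ p + r → q - r ≤ p
q≤p+r⇒q-r≤p {p} {q} {r} h =
  ≤-trans (+-monoˡ-≤ (- r) h) (≤-reflexive (solve 2 (λ p r → p :+ r :- r := p) refl p r))

p-q+q≡p : ∀ p q → p - q + q ≡ p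
p-q+q≡p = solve 2 (λ p q → p :- q :+ q := p) refl

_isWithin_Of_ : ℚ → ℚ → ℚ → Set
a isWithin ε Of b = a ≤ b + ε × b ≤ a + ε

module _ (m : ℕ) where

  private
    k p : ℚ
    k = nat (suc m)
    p = inv (suc m)

    p*[kb] : ∀ b → p * (k * b) ≡ b
    p*[kb] b = trans (sym (*-assoc p k b)) (trans (cong (_* b) (inv*nat m)) (*-identityˡ b))

    0≤p : 0ℚ ≤ p
    0≤p = <⇒≤ (0<inv m)

  -- Read `s` as a sum of `k` values within `½ * ε` of `a`. As `s` is nearly 1, division by `k` puts
  -- `a` near `1/k`.
  average-bounds : ∀ {a s ε} → 0ℚ < ε → k * a ≤ s + k * (½ * ε) → s ≤ k * (a + ½ * ε) →
                   s ≤ 1ℚ → 1ℚ ≤ s + ½ * ε → a isWithin ε Of p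
  average-bounds {a} {s} {ε} 0<ε ka≤ s≤ s≤1 1≤ = upper , lower
    where
    open ≤-Reasoning
    ε′ : ℚ
    ε′ = ½ * ε
    0≤ε′ : 0ℚ ≤ ε′
    0≤ε′ = <⇒≤ (0<* 0<½ 0<ε)
    upper : a ≤ p + ε
    upper = begin
      a                         ≡⟨ p*[kb] a ⟨
      p * (k * a)               ≤⟨ *-monoˡ-≤ 0≤p ka≤ ⟩
      p * (s + k * ε′)          ≡⟨ *-distribˡ-+ p s (k * ε′) ⟩
      p * s + p * (k * ε′)      ≤⟨ +-mono-≤ (*-monoˡ-≤ 0≤p s≤1) (≤-reflexive (p*[kb] ε′)) ⟩
      p * 1ℚ + ε′               ≡⟨ cong (_+ ε′) (*-identityʳ p) ⟩
      p + ε′                    ≤⟨ +-monoʳ-≤ p (<⇒≤ (half<self 0<ε)) ⟩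
      p + ε                     ∎
    lower : p ≤ a + ε
    lower = begin
      p                               ≡⟨ *-identityʳ p ⟨
      p * 1ℚ                          ≤⟨ *-monoˡ-≤ 0≤p (≤-trans 1≤ (+-monoˡ-≤ ε′ s≤)) ⟩
      p * (k * (a + ε′) + ε′)         ≡⟨ *-distribˡ-+ p (k * (a + ε′)) ε′ ⟩
      p * (k * (a + ε′)) + p * ε′     ≤⟨ +-mono-≤ (≤-reflexive (p*[kb] (a + ε′)))
                                           (*-monoʳ-≤-nonNeg ε′ {{ℚ.nonNegative 0≤ε′}} (inv≤1 (suc m))) ⟩
      a + ε′ + 1ℚ * ε′                ≡⟨ solve 2 (λ a e → a :+ con ½ :* e :+ con 1ℚ :* (con ½ :* e) := a :+ e)
                                           refl a ε ⟩
      a + ε                           ∎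

0<inv-pred : ∀ {n} {u z : Fin n} → u ≢ z → 0ℚ < inv (ℕ.pred n)
0<inv-pred {1}           {zero} {zero} u≢z = contradiction refl u≢z
0<inv-pred {suc (suc m)}               u≢z = 0<inv m

-- The `n - 1` values off `u`, enumerated by `Fin.punchIn u`, are all close to `f z` and sum to
-- nearly 1.
nearly-uniform : ∀ {n} (f : Fin n → ℚ) {u z ε} → u ≢ z → 0ℚ < ε → f u ≡ 0ℚ →
  (∀ v → v ≢ u → f v isWithin ½ * ε Of f z) → sum f ≤ 1ℚ → 1ℚ ≤ sum f + ½ * ε →
  f z isWithin ε Of inv (ℕ.pred n)
nearly-uniform {1}           f {zero} {zero} u≢z = contradiction refl u≢z
nearly-uniform {suc (suc m)} f {u} {z} {ε} u≢z 0<ε fu≡0 close Σ≤1 1≤Σ = average-bounds m 0<ε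
  (≤-trans (Σ-≥-const {suc m} (λ j → proj₂ (close _ (Fin.punchInᵢ≢i u j))))
    (≤-reflexive (trans (∑-distrib-+ others (λ _ → ½ * ε))
      (cong (sum others +_) (Σ-const {suc m} (λ _ → ½ * ε) λ _ → refl)))))
  (Σ-≤-const (λ j → proj₁ (close _ (Fin.punchInᵢ≢i u j))))
  (subst (_≤ 1ℚ) Σ≡ Σ≤1)
  (subst (λ s → 1ℚ ≤ s + ½ * ε) Σ≡ 1≤Σ)
  where
  others : Fin (suc m) → ℚ
  others j = f (Fin.punchIn u j)
  Σ≡ : sum f ≡ sum others
  Σ≡ = trans (sum-remove {i = u} f) (trans (cong (_+ sum others) fu≡0) (+-identityˡ (sum others)))

-- Walks

module _ {n : ℕ} (G : SimpleDigraph n) where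

  open SimpleDigraph G

  -- The list holds the vertices of the walk except its endpoint.
  data PathIn : Fin n → List (Fin n) → Fin n → Set where
    []  : ∀ {x} → PathIn x [] x
    _∷_ : ∀ {x y z l} → x ⟶ y → PathIn y l z → PathIn x (x ∷ l) z

module _ {n : ℕ} {G : SimpleDigraph n} where

  open SimpleDigraph G

  infixr 5 _++ₚ_
  _++ₚ_ : ∀ {x y z l l′} → PathIn G x l y → PathIn G y l′ z → PathIn G x (l ++ l′) z
  []      ++ₚ ρ = ρ
  (e ∷ π) ++ₚ ρ = e ∷ (π ++ₚ ρ)

  star⇒path : ∀ {x z} → Star _⟶_ x z → ∃[ l ] PathIn G x l z
  star⇒path ε★           = [] , []
  star⇒path (x⟶y ◅ rest) = let (_ , π) = star⇒path rest in _ , x⟶y ∷ π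

  truncate : ∀ {x y z l} → PathIn G x l z → y ∈ l →
             ∃[ l′ ] PathIn G x l′ y × y ∉ l′ × (∀ {v} → v ∈ l′ → v ∈ l)
  truncate {x} {y} (e ∷ π) y∈ with x Fin.≟ y
  ... | yes refl = [] , [] , (λ ()) , λ ()
  ... | no x≢y with y∈
  ...   | here refl = contradiction refl x≢y
  ...   | there y∈l with truncate π y∈l
  ...     | l′ , π′ , y∉l′ , l′⊆l = x ∷ l′ , e ∷ π′
    , (λ { (here refl) → x≢y refl ; (there y∈l′) → y∉l′ y∈l′ })
    , λ { (here refl) → here refl ; (there v∈l′) → there (l′⊆l v∈l′) }

  -- `exit` searches the tail before the current vertex, so the exit it returns follows the last
  -- visit of `v`. The walk starts at `v`, so it could miss `v` only by being empty, which forces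
  -- `v ≡ w`.
  lastExit : ∀ {u v w l} → PathIn G v l w → u ∉ l → v ≢ w →
             ∃[ v′ ] ∃[ l′ ] v ⟶ v′ × PathIn G v′ l′ w × u ∉ l′ × v ∉ l′
  lastExit {u} {v} {w} π u∉l v≢w with exit π u∉l
    where
    exit : ∀ {x l} → PathIn G x l w → u ∉ l →
           v ∉ l ⊎ (∃[ v′ ] ∃[ l′ ] v ⟶ v′ × PathIn G v′ l′ w × u ∉ l′ × v ∉ l′)
    exit []                u∉l = inj₁ λ ()
    exit {x} (x⟶y ∷ π) u∉l with exit π (u∉l ∘ there)
    ... | inj₂ found = inj₂ found
    ... | inj₁ v∉l with x Fin.≟ v
    ...   | yes refl = inj₂ (_ , _ , x⟶y , π , u∉l ∘ there , v∉l)
    ...   | no x≢v   = inj₁ λ { (here refl) → x≢v refl ; (there v∈l) → v∉l v∈l }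
  ... | inj₂ found = found
  lastExit []      u∉l v≢w | inj₁ v∉l = contradiction refl v≢w
  lastExit (_ ∷ _) u∉l v≢w | inj₁ v∉l = contradiction (here refl) v∉l

-- The random walk

-- `outNeighbour` keeps all lists of out-neighbours nonempty, so that `mean` never takes its
-- conventional value and constants have the right expectation.
module WalkOn {n : ℕ} (G : SimpleDigraph n)
  (outNeighbour : ∀ u → ∃[ w ] SimpleDigraph._⟶_ G u w) where

  open SimpleDigraph G
  open RandomWalk G

  ∈-out⁺ : ∀ {u w} → u ⟶ w → w ∈ outNeighbours u
  ∈-out⁺ {u} {w} = ∈-filter⁺ (u ⟶?_) (∈-allFin w)

  ∈-out⁻ : ∀ {u w} → w ∈ outNeighbours u → u ⟶ w
  ∈-out⁻ {u} w∈ = proj₂ (∈-filter⁻ (u ⟶?_) {xs = allFin n} w∈)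

  length-out : ∀ u → length (outNeighbours u) ℕ.≤ n
  length-out u = ℕ.≤-trans (length-filter (u ⟶?_) (allFin n))
    (ℕ.≤-reflexive (length-tabulate {n = n} (λ i → i)))

  𝔼-mono : ∀ t u {f g} → (∀ ω → f ω ≤ g ω) → 𝔼 t u f ≤ 𝔼 t u g
  𝔼-mono zero    u f≤g = f≤g (u ∷ [])
  𝔼-mono (suc t) u f≤g = mean-mono (outNeighbours u) λ {w} _ → 𝔼-mono t w λ ω → f≤g (u ∷ ω)

  𝔼-cong : ∀ t u {f g} → (∀ ω → f ω ≡ g ω) → 𝔼 t u f ≡ 𝔼 t u g
  𝔼-cong t u f≡g =
    ≤-antisym (𝔼-mono t u (≤-reflexive ∘ f≡g)) (𝔼-mono t u (≤-reflexive ∘ sym ∘ f≡g))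

  𝔼-+ : ∀ t u f g → 𝔼 t u (λ ω → f ω + g ω) ≡ 𝔼 t u f + 𝔼 t u g
  𝔼-+ zero    u f g = refl
  𝔼-+ (suc t) u f g = trans
    (mean-cong (outNeighbours u) (λ {w} _ → 𝔼-+ t w (f ∘ (u ∷_)) (g ∘ (u ∷_))))
    (mean-+ (λ w → 𝔼 t w (f ∘ (u ∷_))) (λ w → 𝔼 t w (g ∘ (u ∷_))) (outNeighbours u))

  𝔼-const : ∀ t u c → 𝔼 t u (λ _ → c) ≡ c
  𝔼-const zero    u c = refl
  𝔼-const (suc t) u c = trans
    (mean-cong (outNeighbours u) (λ {w} _ → 𝔼-const t w c))
    (mean-const (outNeighbours u) (∈-out⁺ (proj₂ (outNeighbour u))) c)

  𝔼-sum : ∀ t u {k} (f : Fin k → Vec (Fin n) (suc t) → ℚ) →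
          𝔼 t u (λ ω → sum (λ i → f i ω)) ≡ sum (λ i → 𝔼 t u (f i))
  𝔼-sum t u {zero}  f = 𝔼-const t u 0ℚ
  𝔼-sum t u {suc k} f = trans (𝔼-+ t u (f zero) (λ ω → sum (λ i → f (suc i) ω)))
    (cong (𝔼 t u (f zero) +_) (𝔼-sum t u (f ∘ suc)))

  𝔼-start : ∀ t u {f c} → (∀ ω → f (u ∷ ω) ≡ c) → 𝔼 t u f ≡ c
  𝔼-start zero    u h = h []
  𝔼-start (suc t) u h = trans
    (mean-cong (outNeighbours u) (λ {w} _ → trans (𝔼-cong t w h) (𝔼-const t w _)))
    (mean-const (outNeighbours u) (∈-out⁺ (proj₂ (outNeighbour u))) _)

  𝔼Hit : ℕ → Fin n → Fin n → (List (Fin n) → ℚ) → ℚ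
  𝔼Hit t x z φ = 𝔼 t x (atHit z φ)

  𝔼Hit-here : ∀ t z φ → 𝔼Hit t z z φ ≡ φ []
  𝔼Hit-here t z φ = 𝔼-start t z (atHit-here z φ)

  𝔼Hit-zero : ∀ {x z} φ → x ≢ z → 𝔼Hit 0 x z φ ≡ 0ℚ
  𝔼Hit-zero {x} {z} φ x≢z = trans (atHit-there φ [] x≢z) (atHit-[] z (φ ∘ (x ∷_)))

  -- First-step analysis: conditioning on the move from `x` to `w` prepends `x` to the prefix.
  𝔼Hit-suc : ∀ t {x z} φ → x ≢ z →
    𝔼Hit (suc t) x z φ ≡ mean (map (λ w → 𝔼Hit t w z (φ ∘ (x ∷_))) (outNeighbours x))
  𝔼Hit-suc t {x} φ x≢z =
    mean-cong (outNeighbours x) λ {w} _ → 𝔼-cong t w λ ω → atHit-there φ ω x≢z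

  𝔼-nonNeg : ∀ t u {f} → (∀ ω → 0ℚ ≤ f ω) → 0ℚ ≤ 𝔼 t u f
  𝔼-nonNeg t u {f} 0≤f = subst (_≤ 𝔼 t u f) (𝔼-const t u 0ℚ) (𝔼-mono t u 0≤f)

  𝔼Hit-nonNeg : ∀ t x z {φ} → (∀ l → 0ℚ ≤ φ l) → 0ℚ ≤ 𝔼Hit t x z φ
  𝔼Hit-nonNeg t x z 0≤φ = 𝔼-nonNeg t x (atHit-nonNeg z 0≤φ)

  𝔼Hit-+ : ∀ t x z φ ψ χ → (∀ l → φ l ≡ ψ l + χ l) → 𝔼Hit t x z φ ≡ 𝔼Hit t x z ψ + 𝔼Hit t x z χ
  𝔼Hit-+ t x z φ ψ χ φ≡ψ+χ = trans (𝔼-cong t x (atHit-+ z φ≡ψ+χ)) (𝔼-+ t x (atHit z ψ) (atHit z χ))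

  Path : Fin n → List (Fin n) → Fin n → Set
  Path = PathIn G

  𝔼Hit≢0⇒path : ∀ t x z φ → 𝔼Hit t x z φ ≢ 0ℚ → ∃[ l ] Path x l z × z ∉ l × φ l ≢ 0ℚ
  𝔼Hit≢0⇒path t x z φ ≢0 with x Fin.≟ z
  ... | yes refl = [] , [] , (λ ()) , λ φ≡0 → ≢0 (trans (𝔼Hit-here t x φ) φ≡0)
  𝔼Hit≢0⇒path zero    x z φ ≢0 | no x≢z = contradiction (𝔼Hit-zero φ x≢z) ≢0
  𝔼Hit≢0⇒path (suc t) x z φ ≢0 | no x≢z
    with mean≢0⇒∃ (λ w → 𝔼Hit t w z (φ ∘ (x ∷_))) (outNeighbours x) (≢0 ∘ trans (𝔼Hit-suc t φ x≢z))
  ... | w , w∈ , h≢0 with 𝔼Hit≢0⇒path t w z (φ ∘ (x ∷_)) h≢0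
  ...   | l , π , z∉l , φ≢0 =
    x ∷ l , ∈-out⁻ w∈ ∷ π , (λ { (here refl) → x≢z refl ; (there z∈l) → z∉l z∈l }) , φ≢0

  κ : ℚ
  κ = inv n

  0<κ : Fin n → 0ℚ < κ
  0<κ = 0<inv-size

  mean-out-bump : ∀ f {x w a δ} → 0ℚ ≤ δ → (∀ {y} → x ⟶ y → a ≤ f y) → x ⟶ w → a + δ ≤ f w →
                  a + κ * δ ≤ mean (map f (outNeighbours x))
  mean-out-bump f {x} 0≤δ h x⟶w b =
    mean-bump f (outNeighbours x) (length-out x) 0≤δ (h ∘ ∈-out⁻) (∈-out⁺ x⟶w) b

  -- The walk follows the path with probability at least `κ` to the power of its length, and `z ∉ l`
  -- makes the end of the path the first visit of `z`. The weight is read off there, so the constant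
  -- is the same for all `φ` and `t`.
  path⇒𝔼Hit≥ : ∀ {x l z} → Path x l z → z ∉ l →
    ∃[ c ] 0ℚ < c × (∀ φ → (∀ l → 0ℚ ≤ φ l) → ∀ t → c * φ l ≤ 𝔼Hit (length l ℕ.+ t) x z φ)
  path⇒𝔼Hit≥ {x} [] z∉l = 1ℚ , 0<1 , λ φ 0≤φ t →
    ≤-reflexive (trans (*-identityˡ (φ [])) (sym (𝔼Hit-here t x φ)))
  path⇒𝔼Hit≥ {x} {_ ∷ l} {z} (x⟶y ∷ π) z∉l with path⇒𝔼Hit≥ π (z∉l ∘ there)
  ... | c , 0<c , c≤ = κ * c , 0<* (0<κ x) 0<c , λ φ 0≤φ t →
    let φ′ = φ ∘ (x ∷_)
        f  = λ w → 𝔼Hit (length l ℕ.+ t) w z φ′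
        open ≤-Reasoning in begin
    κ * c * φ (x ∷ l)                ≡⟨ *-assoc κ c (φ (x ∷ l)) ⟩
    κ * (c * φ (x ∷ l))              ≡⟨ +-identityˡ _ ⟨
    0ℚ + κ * (c * φ (x ∷ l))         ≤⟨ mean-out-bump f (0≤* (<⇒≤ 0<c) (0≤φ (x ∷ l)))
                                          (λ {w} _ → 𝔼Hit-nonNeg (length l ℕ.+ t) w z (0≤φ ∘ (x ∷_))) x⟶y
                                          (≤-trans (≤-reflexive (+-identityˡ _)) (c≤ φ′ (0≤φ ∘ (x ∷_)) t)) ⟩
    mean (map f (outNeighbours x))   ≡⟨ 𝔼Hit-suc (length l ℕ.+ t) φ (λ { refl → z∉l (here refl) }) ⟨
    𝔼Hit (suc (length l ℕ.+ t)) x z φ ∎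

  -- Hitting probabilities tend to 1.

  hitBy : ℕ → Fin n → Fin n → ℚ
  hitBy t x z = 𝔼Hit t x z (λ _ → 1ℚ)

  HitBound : Fin n → ℕ → ℚ → Set
  HitBound z t b = ∀ x → b ≤ hitBy t x z

  hitBound-step : ∀ {z b x w δ} t → 0ℚ ≤ δ → x ≢ z → HitBound z t b → x ⟶ w →
                  b + δ ≤ hitBy t w z → b + κ * δ ≤ hitBy (suc t) x z
  hitBound-step {z} {x = x} t 0≤δ x≢z h x⟶w b≤ =
    ≤-trans (mean-out-bump (λ w → hitBy t w z) 0≤δ (λ {y} _ → h y) x⟶w b≤)
      (≤-reflexive (sym (𝔼Hit-suc t (λ _ → 1ℚ) x≢z)))

  hitBound-suc : ∀ {z b} t → b ≤ 1ℚ → HitBound z t b → HitBound z (suc t) b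
  hitBound-suc {z} {b} t b≤1 h x with x Fin.≟ z
  ... | yes refl = ≤-trans b≤1 (≤-reflexive (sym (𝔼Hit-here (suc t) z _)))
  ... | no x≢z   = let (w , x⟶w) = outNeighbour x in
    ≤-trans (≤-reflexive (trans (sym (+-identityʳ b)) (cong (b +_) (sym (*-zeroʳ κ)))))
      (hitBound-step t ≤-refl x≢z h x⟶w (≤-trans (≤-reflexive (+-identityʳ b)) (h w)))

  hitBound-+ : ∀ {z b} s t → b ≤ 1ℚ → HitBound z t b → HitBound z (s ℕ.+ t) b
  hitBound-+ zero    t b≤1 h = h
  hitBound-+ (suc s) t b≤1 h = hitBound-suc (s ℕ.+ t) b≤1 (hitBound-+ s t b≤1 h)

  κ≤1 : κ ≤ 1ℚ
  κ≤1 = inv≤1 n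

  -- Read `M` as a bound on the probability of missing `z` within `t` steps from any start. First
  -- following a path of at most `s` edges to `z` recovers at least the share `pow κ s` of it.
  hitBound-path : ∀ {z M x l} s t → 0ℚ ≤ M → HitBound z t (1ℚ - M) → Path x l z → length l ℕ.≤ s →
                  1ℚ - M + pow κ s * M ≤ hitBy (s ℕ.+ t) x z
  hitBound-path {z} {M} {x} s t 0≤M h π l≤s with x Fin.≟ z
  ... | yes refl = begin
    1ℚ - M + pow κ s * M   ≤⟨ +-monoʳ-≤ (1ℚ - M) (*-monoʳ-≤-nonNeg M {{ℚ.nonNegative 0≤M}}
                                (pow≤1 (<⇒≤ (0<κ x)) κ≤1 s)) ⟩
    1ℚ - M + 1ℚ * M        ≡⟨ solve 1 (λ m → con 1ℚ :- m :+ con 1ℚ :* m := con 1ℚ) refl M ⟩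
    1ℚ                     ≡⟨ 𝔼Hit-here (s ℕ.+ t) z _ ⟨
    hitBy (s ℕ.+ t) x z    ∎
    where open ≤-Reasoning
  hitBound-path s t 0≤M h [] l≤s | no x≢z = contradiction refl x≢z
  hitBound-path {z} {M} {x} (suc s) t 0≤M h (x⟶y ∷ π) (s≤s l≤s) | no x≢z =
    ≤-trans (≤-reflexive (cong (1ℚ - M +_) (*-assoc κ (pow κ s) M)))
      (hitBound-step (s ℕ.+ t) (0≤* (0≤pow (<⇒≤ (0<κ x)) κ≤1 s) 0≤M) x≢z
        (hitBound-+ s t (p-q≤p 0≤M) h) x⟶y (hitBound-path s t 0≤M h π l≤s))

  -- Let `N` bound the lengths of paths to `z` from all vertices. Each block of `N` steps multiplies
  -- the bound on a miss by `1ℚ - δ`, so it decays geometrically.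
  eventually-hit : StronglyConnected → ∀ z {η} → 0ℚ < η → Eventually (λ t → HitBound z t (1ℚ - η))
  eventually-hit connected z {η} 0<η =
    let (j , small) = pow-small 0<δ δ≤1 η 0<η in
    j ℕ.* N , λ t jN≤t x → begin
      1ℚ - η                                 ≤⟨ +-monoʳ-≤ 1ℚ (neg-antimono-≤ small) ⟩
      -- The `t - jN` steps left over do not lower the bound.
      1ℚ - pow (1ℚ - δ) j                    ≤⟨ hitBound-+ (t ℕ.∸ j ℕ.* N) (j ℕ.* N) (p-q≤p (0≤M j)) (iterate j) x ⟩
      hitBy (t ℕ.∸ j ℕ.* N ℕ.+ j ℕ.* N) x z  ≡⟨ cong (λ t → hitBy t x z) (ℕ.m∸n+n≡m jN≤t) ⟩
      hitBy t x z                            ∎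
    where
    open ≤-Reasoning
    paths : ∀ x → ∃[ l ] Path x l z
    paths x = star⇒path (connected x z)
    bound : ∃[ N ] ∀ x → length (proj₁ (paths x)) ℕ.≤ N
    bound = bounded (λ x → length (proj₁ (paths x)))
    N : ℕ
    N = proj₁ bound
    δ : ℚ
    δ = pow κ N
    0<δ : 0ℚ < δ
    0<δ = 0<pow (0<κ z) N
    δ≤1 : δ ≤ 1ℚ
    δ≤1 = pow≤1 (<⇒≤ (0<κ z)) κ≤1 N
    0≤M : ∀ j → 0ℚ ≤ pow (1ℚ - δ) j
    0≤M = 0≤pow (0≤q-p δ≤1) (p-q≤p (<⇒≤ 0<δ))
    iterate : ∀ j → HitBound z (j ℕ.* N) (1ℚ - pow (1ℚ - δ) j)
    iterate zero    x = 𝔼Hit-nonNeg 0 x z (λ _ → <⇒≤ 0<1)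
    iterate (suc j) x = ≤-trans
      (≤-reflexive (solve 2 (λ m d → con 1ℚ :- (con 1ℚ :- d) :* m := con 1ℚ :- m :+ d :* m) refl
        (pow (1ℚ - δ) j) δ))
      (hitBound-path N (j ℕ.* N) (0≤M j) (iterate j) (proj₂ (paths x)) (proj₂ bound x))

  -- Distribution of the end of the cover tour.

  ℙL≡𝔼Hit : ∀ u z t → ℙL u z t ≡ 𝔼Hit t u z (coversWeight z)
  ℙL≡𝔼Hit u z t = 𝔼-cong t u (λ ω → endsAt≡atHit ω z)

  Σ-ℙL≤1 : ∀ u t → sum (λ z → ℙL u z t) ≤ 1ℚ
  Σ-ℙL≤1 u t = begin
    sum (λ z → ℙL u z t)                               ≡⟨ 𝔼-sum t u (λ z ω → 𝟙 (coverTourEndsAt? ω z)) ⟨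
    𝔼 t u (λ ω → sum (λ z → 𝟙 (coverTourEndsAt? ω z))) ≤⟨ 𝔼-mono t u Σ-endsAt≤1 ⟩
    𝔼 t u (λ _ → 1ℚ)                                   ≡⟨ 𝔼-const t u 1ℚ ⟩
    1ℚ                                                 ∎
    where open ≤-Reasoning

  Σ-hitBy≤Σ-ℙL : ∀ u t → sum (λ z → hitBy t u z) + 1ℚ ≤ sum (λ z → ℙL u z t) + nat n
  Σ-hitBy≤Σ-ℙL u t = begin
    sum (λ z → hitBy t u z) + 1ℚ                 ≡⟨ cong₂ _+_ (𝔼-sum t u (λ z → atHit z (λ _ → 1ℚ))) (𝔼-const t u 1ℚ) ⟨
    𝔼 t u hits + 𝔼 t u (λ _ → 1ℚ)                ≡⟨ 𝔼-+ t u hits (λ _ → 1ℚ) ⟨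
    𝔼 t u (λ ω → hits ω + 1ℚ)                    ≤⟨ 𝔼-mono t u Σ-hit≤Σ-endsAt ⟩
    𝔼 t u (λ ω → sum (λ z → ends z ω + 1ℚ))      ≡⟨ 𝔼-cong t u sum-ends+1 ⟩
    𝔼 t u (λ ω → sum (λ z → ends z ω) + nat n)   ≡⟨ 𝔼-+ t u (λ ω → sum (λ z → ends z ω)) (λ _ → nat n) ⟩
    𝔼 t u (λ ω → sum (λ z → ends z ω)) + 𝔼 t u (λ _ → nat n)
                                                 ≡⟨ cong₂ _+_ (𝔼-sum t u ends) (𝔼-const t u (nat n)) ⟩
    sum (λ z → ℙL u z t) + nat n                 ∎
    where
    open ≤-Reasoning
    hits : Vec (Fin n) (suc t) → ℚ
    hits ω = sum (λ z → atHit z (λ _ → 1ℚ) ω)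
    ends : Fin n → Vec (Fin n) (suc t) → ℚ
    ends z ω = 𝟙 (coverTourEndsAt? ω z)
    sum-ends+1 : ∀ ω → sum (λ z → ends z ω + 1ℚ) ≡ sum (λ z → ends z ω) + nat n
    sum-ends+1 ω = trans (∑-distrib-+ (λ z → ends z ω) (λ _ → 1ℚ))
      (cong (sum (λ z → ends z ω) +_) (trans (Σ-const {n} (λ _ → 1ℚ) (λ _ → refl)) (*-identityʳ (nat n))))

  -- From some time on each vertex is missed with probability at most `κ * ε`, so the tour is
  -- unfinished with probability at most `ε`.
  1≤Σ-ℙL : StronglyConnected → ∀ u {ε} → 0ℚ < ε → Eventually (λ t → 1ℚ ≤ sum (λ z → ℙL u z t) + ε)
  1≤Σ-ℙL connected u {ε} 0<ε = eventually-map
    (λ t h → coverage-bound {nat n} {κ} {ε} {sum (λ z → hitBy t u z)} {sum (λ z → ℙL u z t)}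
      (inv*nat-size u) (Σ-≥-const (λ z → h z u)) (Σ-hitBy≤Σ-ℙL u t))
    (eventually-∀ (λ z → eventually-hit connected z (0<* (0<κ u) 0<ε)))

  -- At time 0, the first visit of `u`, the vertex `v` is still unvisited.
  ℙL-self : ∀ {u v} → v ≢ u → ∀ t → ℙL u u t ≡ 0ℚ
  ℙL-self {u} {v} v≢u t = trans (ℙL≡𝔼Hit u u t) (trans (𝔼Hit-here t u (coversWeight u))
    (𝟙-false (covers? u []) λ c → [ v≢u , (λ ()) ] (c v)))

module _ {n : ℕ} {G : SimpleDigraph n} where

  open SimpleDigraph G

  leave : ∀ {x y} → x ≢ y → Star _⟶_ x y → ∃[ w ] x ⟶ w
  leave x≢y ε★        = contradiction refl x≢y
  leave x≢y (x⟶w ◅ _) = _ , x⟶w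

  strongly-connected⇒outNeighbour : StronglyConnected → ∀ {a b} → a ≢ b → ∀ u → ∃[ w ] u ⟶ w
  strongly-connected⇒outNeighbour connected {a} {b} a≢b u with u Fin.≟ a
  ... | yes refl = leave a≢b (connected a b)
  ... | no u≢a   = leave u≢a (connected u a)

-- The graph-theoretic part of the proof

-- Uniformity enters only through these parameters: positivity of all end probabilities, and what
-- the first step of a tour yields for a non-edge and for an edge.
module CoveringPaths {n : ℕ} (G : SimpleDigraph n)
  (covering-path : ∀ {x z} → x ≢ z → ∃[ l ] PathIn G x l z × z ∉ l × Covers z l)
  (secondLast⁻ : ∀ {u z w l} → u ≢ z → ¬ SimpleDigraph._⟶_ G u z → SimpleDigraph._⟶_ G u w →
                 PathIn G w l z → z ∉ l → ¬ CoversAvoiding u z l)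
  (secondLast⁺ : ∀ {u z x} → SimpleDigraph._⟶_ G u z → x ≢ u → x ≢ z →
                 ∃[ w ] ∃[ l ] SimpleDigraph._⟶_ G u w × w ≢ z × PathIn G w l z × z ∉ l ×
                               CoversAvoiding u z l)
  where

  open SimpleDigraph G

  -- Strong connectivity after deletion of `z`: a covering path to `z` meets `y` before `z` and is
  -- cut at its first visit of `y`.
  avoiding-path : ∀ {x y z} → x ≢ z → y ≢ z → ∃[ l ] PathIn G x l y × z ∉ l × y ∉ l
  avoiding-path {y = y} x≢z y≢z with covering-path x≢z
  ... | l , π , z∉l , covers with covers y
  ...   | inj₁ y≡z = contradiction y≡z y≢z
  ...   | inj₂ y∈l with truncate π y∈l
  ...     | l′ , π′ , y∉l′ , l′⊆l = l′ , π′ , z∉l ∘ l′⊆l , y∉l′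

  -- Only the last edge, into `v`, is replaced: from the vertex before it a path that avoids `v`
  -- leads to `u`.
  redirect : ∀ {u v w l} → PathIn G w l v → v ∉ l → u ∉ l → w ≢ v → u ≢ v →
             ∃[ l⁺ ] PathIn G w l⁺ u × u ∉ l⁺ × v ∉ l⁺ × (∀ {x} → x ∈ l → x ∈ l⁺)
  redirect [] v∉l u∉l w≢v u≢v = contradiction refl w≢v
  redirect (_ ∷ []) v∉l u∉l w≢v u≢v with avoiding-path w≢v u≢v
  -- An empty path would mean `w ≡ u`, but `w` lies on `l` and `u` does not.
  ... | _ , []    , _    , _     = contradiction (here refl) u∉l
  ... | _ , e ∷ π , v∉l⁺ , u∉l⁺ = _ , e ∷ π , u∉l⁺ , v∉l⁺ , λ { (here refl) → here refl }
  redirect {u} {w = w} (w⟶y ∷ (e ∷ π)) v∉l u∉l w≢v u≢v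
    with redirect (e ∷ π) (v∉l ∘ there) (u∉l ∘ there) (λ { refl → v∉l (there (here refl)) }) u≢v
  ... | l⁺ , π⁺ , u∉l⁺ , v∉l⁺ , l⊆l⁺ = w ∷ l⁺ , w⟶y ∷ π⁺
    , (λ { (here refl) → u∉l (here refl) ; (there u∈) → u∉l⁺ u∈ })
    , (λ { (here refl) → w≢v refl ; (there v∈) → v∉l⁺ v∈ })
    , λ { (here refl) → here refl ; (there x∈) → there (l⊆l⁺ x∈) }

  -- A walk from `v` to `w` that avoids `u` also avoids `v` after its last visit there. Appending
  -- the redirected covering walk exchanges the roles of `u` and `v`.
  swap-last : ∀ {u v w l} → u ≢ v → u ≢ w → w ≢ v → PathIn G w l v → v ∉ l → CoversAvoiding u v l →
              ∃[ w′ ] ∃[ l′ ] v ⟶ w′ × PathIn G w′ l′ u × u ∉ l′ × CoversAvoiding v u l′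
  swap-last u≢v u≢w w≢v π v∉l (covers , u∉l) with avoiding-path (u≢v ∘ sym) (u≢w ∘ sym)
  ... | _ , π₀ , u∉l₀ , _ with lastExit π₀ u∉l₀ (w≢v ∘ sym) | redirect π v∉l u∉l w≢v u≢v
  ... | w′ , l₁ , v⟶w′ , π₁ , u∉l₁ , v∉l₁ | l₂ , π₂ , u∉l₂ , v∉l₂ , l⊆l₂ =
    w′ , l₁ ++ l₂ , v⟶w′ , π₁ ++ₚ π₂ , [ u∉l₁ , u∉l₂ ] ∘ ∈-++⁻ l₁
    , (λ y → [ (λ y≡v → inj₂ (here y≡v))
             , (λ { (here y≡u)  → inj₁ y≡u
                  ; (there y∈l) → inj₂ (there (∈-++⁺ʳ l₁ (l⊆l₂ y∈l))) }) ] (covers y))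
    , [ v∉l₁ , v∉l₂ ] ∘ ∈-++⁻ l₁

  bidirected : StronglyConnected → ∀ {u v} → u ⟶ v → v ⟶ u
  bidirected connected {u} {v} u⟶v = decidable-stable (v ⟶? u) λ v↛u →
    impossible v↛u (leave {G = G} (u≢v ∘ sym) (connected v u))
    where
    u≢v : u ≢ v
    u≢v u≡v = irrefl u≡v u⟶v

    impossible : ¬ (v ⟶ u) → ¬ (∃[ x ] v ⟶ x)
    -- `x` is the third vertex that `secondLast⁺` asks for: it is not `u` because `v` has no edge to
    -- `u`, and not `v` because there are no loops.
    impossible v↛u (x , v⟶x)
      with secondLast⁺ u⟶v (λ x≡u → v↛u (subst (v ⟶_) x≡u v⟶x)) (λ x≡v → irrefl (sym x≡v) v⟶x)
    ... | w , l , u⟶w , w≢v , π , v∉l , covers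
      with swap-last u≢v (λ u≡w → irrefl u≡w u⟶w) w≢v π v∉l covers
    ...   | w′ , l′ , v⟶w′ , π′ , u∉l′ , covers′ =
      secondLast⁻ (u≢v ∘ sym) v↛u v⟶w′ π′ u∉l′ covers′

-- The consequences of uniformity

module Uniform {n : ℕ} (G : SimpleDigraph n)
         (connected : SimpleDigraph.StronglyConnected G)
         (uniform : ∀ u v w → u ≢ v → u ≢ w → v ≢ w → RandomWalk.ℙL G u v ≃ RandomWalk.ℙL G u w)
         {a b : Fin n} (a≢b : a ≢ b) where

  open SimpleDigraph G
  open RandomWalk G
  open WalkOn G (strongly-connected⇒outNeighbour {G = G} connected a≢b)

  p : ℚ
  p = inv (ℕ.pred n)

  0<p : 0ℚ < p
  0<p = 0<inv-pred a≢b

  Near : ℚ → ℕ → Set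
  Near ε t = ∀ u z → u ≢ z → ℙL u z t isWithin ε Of p

  eventually-close : ∀ u z {ε} → u ≢ z → 0ℚ < ε →
    Eventually (λ t → ∀ v → v ≢ u → ℙL u v t isWithin ε Of ℙL u z t)
  eventually-close u z {ε} u≢z 0<ε = eventually-∀ close
    where
    close : ∀ v → Eventually (λ t → v ≢ u → ℙL u v t isWithin ε Of ℙL u z t)
    close v with v Fin.≟ u | v Fin.≟ z
    ... | yes v≡u | _        = 0 , λ _ _ v≢u → contradiction v≡u v≢u
    ... | no _    | yes refl = 0 , λ _ _ _ → p≤p+q (<⇒≤ 0<ε) , p≤p+q (<⇒≤ 0<ε)
    ... | no v≢u  | no v≢z   = let (N , h) = uniform u v z (v≢u ∘ sym) u≢z v≢z ε 0<ε in
      N , λ t N≤t _ → ∣p-q∣<r⇒p≤q+r (h t N≤t) , ∣p-q∣<r⇒q≤p+r {ℙL u v t} (h t N≤t)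

  -- For each start, the `n - 1` limits at the other vertices agree by hypothesis and sum to 1.
  ℙL→p : ∀ {ε} → 0ℚ < ε → Eventually (Near ε)
  ℙL→p {ε} 0<ε = eventually-∀ λ u → eventually-∀ λ z → at u z
    where
    at : ∀ u z → Eventually (λ t → u ≢ z → ℙL u z t isWithin ε Of p)
    at u z with u Fin.≟ z
    ... | yes u≡z = 0 , λ _ _ u≢z → contradiction u≡z u≢z
    ... | no u≢z  = eventually-map
      (λ t (close , 1≤Σ) _ → nearly-uniform (λ v → ℙL u v t) u≢z 0<ε
        (ℙL-self (u≢z ∘ sym) t) close (Σ-ℙL≤1 u t) 1≤Σ)
      (eventually-× (eventually-close u z u≢z (0<* 0<½ 0<ε)) (1≤Σ-ℙL connected u (0<* 0<½ 0<ε)))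

  -- For `u ≢ z`, the conditional probability that the tour from `u` ends at `z` by time `suc t`,
  -- given a first step to `w`; `u` is prepended because it counts as visited.
  afterStep : ℕ → Fin n → Fin n → Fin n → ℚ
  afterStep t u z w = 𝔼Hit t w z (coversWeight z ∘ (u ∷_))

  -- The probability that the walk from w visits z by time t, all other vertices but u before
  -- that, and u not before that: then z is visited second last and u last.
  secondLast : ℕ → Fin n → Fin n → Fin n → ℚ
  secondLast t u z w = 𝔼Hit t w z (λ l → 𝟙 (coversAvoiding? u z l))

  ℙL-suc : ∀ t {u z} → u ≢ z → ℙL u z (suc t) ≡ mean (map (afterStep t u z) (outNeighbours u))
  ℙL-suc t {u} {z} u≢z = trans (ℙL≡𝔼Hit u z (suc t)) (𝔼Hit-suc t (coversWeight z) u≢z)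

  afterStep-split : ∀ t {u z} w → u ≢ z → afterStep t u z w ≡ ℙL w z t + secondLast t u z w
  afterStep-split t {u} {z} w u≢z =
    trans
      (𝔼Hit-+ t w z (coversWeight z ∘ (u ∷_)) (coversWeight z) (λ l → 𝟙 (coversAvoiding? u z l))
        (covers-split u≢z))
      (cong (_+ secondLast t u z w) (sym (ℙL≡𝔼Hit w z t)))

  afterStep-self : ∀ t {u z x} → x ≢ u → x ≢ z → afterStep t u z z ≡ 0ℚ
  afterStep-self t {u} {z} {x} x≢u x≢z = trans (𝔼Hit-here t z (coversWeight z ∘ (u ∷_)))
    (𝟙-false (covers? z (u ∷ [])) λ c → [ x≢z , (λ { (here x≡u) → x≢u x≡u ; (there ()) }) ] (c x))

  secondLast-nonNeg : ∀ t u z w → 0ℚ ≤ secondLast t u z w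
  secondLast-nonNeg t u z w = 𝔼Hit-nonNeg t w z λ l → 0≤𝟙 (coversAvoiding? u z l)

  -- No out-neighbour of `u` is `z`, so each contributes at least `p - ε` to the mean. The extra `c`
  -- at `w` lifts the mean by `κ * c`, yet it is at most `p + ε`. The mean belongs to time `suc T`
  -- and its terms to `T`, hence two nearness hypotheses.
  secondLast≤ : ∀ {u z w ε c} T → u ≢ z → ¬ (u ⟶ z) → u ⟶ w → Near ε T → Near ε (suc T) →
                0ℚ ≤ c → c ≤ secondLast T u z w → κ * c ≤ ε + ε
  secondLast≤ {u} {z} {w} {ε} {c} T u≢z u↛z u⟶w near near′ 0≤c c≤ =
    increment≤ {p} {ε} (mean-out-bump (afterStep T u z) 0≤c after≥ u⟶w after-w≥)
      (subst (_≤ p + ε) (ℙL-suc T u≢z) (proj₁ (near′ u z u≢z)))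
    where
    ℙL≥ : ∀ {y} → u ⟶ y → p - ε ≤ ℙL y z T
    ℙL≥ {y} u⟶y = q≤p+r⇒q-r≤p (proj₂ (near y z λ { refl → u↛z u⟶y }))
    after≥ : ∀ {y} → u ⟶ y → p - ε ≤ afterStep T u z y
    after≥ {y} u⟶y = ≤-trans (ℙL≥ u⟶y)
      (≤-trans (p≤p+q (secondLast-nonNeg T u z y)) (≤-reflexive (sym (afterStep-split T y u≢z))))
    after-w≥ : p - ε + c ≤ afterStep T u z w
    after-w≥ = ≤-trans (+-mono-≤ (ℙL≥ u⟶w) c≤) (≤-reflexive (sym (afterStep-split T w u≢z)))

  non-neighbour⇒never-secondLast : ∀ {u z w l} → u ≢ z → ¬ (u ⟶ z) → u ⟶ w →
    Path w l z → z ∉ l → ¬ CoversAvoiding u z l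
  non-neighbour⇒never-secondLast {u} {z} {w} {l} u≢z u↛z u⟶w π z∉l covers =
    let (c , 0<c , c≤) = path⇒𝔼Hit≥ π z∉l
        0<κc           = 0<* {κ} {c} (0<κ u) 0<c
        -- With this error `ε + ε` is half of `κ * c`.
        (N , near)     = ℙL→p (0<quarter {κ * c} 0<κc)
        N≤T            = ℕ.m≤n+m N (length l)
        c≤secondLast   = ≤-trans
          (≤-reflexive (trans (sym (*-identityʳ c)) (cong (c *_) (sym (𝟙-true (coversAvoiding? u z l) covers)))))
          (c≤ (λ l → 𝟙 (coversAvoiding? u z l)) (λ l → 0≤𝟙 (coversAvoiding? u z l)) N)
    in p≰2quarters {κ * c} 0<κc (secondLast≤ {ε = quarter (κ * c)} (length l ℕ.+ N) u≢z u↛z u⟶w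
         (near _ N≤T) (near _ (ℕ.m≤n⇒m≤1+n N≤T)) (<⇒≤ 0<c) c≤secondLast)

  -- The fixed time makes this decidable, so a witness can be drawn from the refutation of its
  -- absence.
  HasSecondLast : ℕ → Fin n → Fin n → Set
  HasSecondLast t u z = ∃[ w ] u ⟶ w × w ≢ z × secondLast t u z w ≢ 0ℚ

  hasSecondLast? : ∀ t u z → Dec (HasSecondLast t u z)
  hasSecondLast? t u z = Fin.any? λ w → (u ⟶? w) ×-dec ¬? (w Fin.≟ z) ×-dec ¬? (secondLast t u z w ≟ 0ℚ)

  -- Each term is then at most `p + ε` and the term at `z` is 0, which pulls the mean at least
  -- `κ * p` below `p + ε`; but the mean is at least `p - ε`.
  ¬hasSecondLast : ∀ {u z x ε} T → u ⟶ z → x ≢ u → x ≢ z → 0ℚ < ε → Near ε T → Near ε (suc T) →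
                   ¬ HasSecondLast T u z → κ * p ≤ ε + ε
  ¬hasSecondLast {u} {z} {x} {ε} T u⟶z x≢u x≢z 0<ε near near′ none = begin
    κ * p                             ≡⟨ +-identityˡ (κ * p) ⟨
    0ℚ + κ * p                        ≤⟨ mean-out-bump gap (<⇒≤ 0<p) 0≤gap u⟶z p≤gap ⟩
    mean (map gap (outNeighbours u))  ≤⟨ decrement≤ {p} {ε} mean-gap
                                           (subst (λ a → p ≤ a + ε) (ℙL-suc T u≢z) (proj₂ (near′ u z u≢z))) ⟩
    ε + ε                             ∎
    where
    open ≤-Reasoning
    u≢z : u ≢ z
    u≢z u≡z = irrefl u≡z u⟶z
    -- The shortfall is nonnegative on the out-neighbours and at least `p` at `z`, so the lower
    -- bound for a mean with one raised entry applies to it.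
    gap : Fin n → ℚ
    gap w = (p + ε) - afterStep T u z w
    after≤ : ∀ {w} → u ⟶ w → w ≢ z → afterStep T u z w ≤ p + ε
    after≤ {w} u⟶w w≢z = ≤-trans
      (≤-reflexive (trans (afterStep-split T w u≢z)
        (trans (cong (ℙL w z T +_) (decidable-stable (secondLast T u z w ≟ 0ℚ) λ ≢0 → none (w , u⟶w , w≢z , ≢0)))
          (+-identityʳ (ℙL w z T)))))
      (proj₁ (near w z w≢z))
    p≤gap : 0ℚ + p ≤ gap z
    p≤gap = ≤-trans (≤-reflexive (+-identityˡ p)) (≤-trans (p≤p+q (<⇒≤ 0<ε))
      (≤-reflexive (trans (sym (+-identityʳ (p + ε))) (cong (λ g → (p + ε) - g) (sym (afterStep-self T x≢u x≢z))))))
    0≤gap : ∀ {w} → u ⟶ w → 0ℚ ≤ gap w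
    0≤gap {w} u⟶w = by-cases (w Fin.≟ z)
      where
      by-cases : Dec (w ≡ z) → 0ℚ ≤ gap w
      by-cases (yes refl) = ≤-trans (<⇒≤ 0<p) (≤-trans (≤-reflexive (sym (+-identityˡ p))) p≤gap)
      by-cases (no w≢z)   = 0≤q-p (after≤ u⟶w w≢z)
    mean-gap : mean (map gap (outNeighbours u)) + mean (map (afterStep T u z) (outNeighbours u)) ≡ p + ε
    mean-gap = trans (sym (mean-+ gap (afterStep T u z) (outNeighbours u)))
      (trans (mean-cong (outNeighbours u) λ {w} _ → p-q+q≡p (p + ε) (afterStep T u z w))
        (mean-const (outNeighbours u) (∈-out⁺ u⟶z) (p + ε)))

  neighbour⇒secondLast : ∀ {u z x} → u ⟶ z → x ≢ u → x ≢ z →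
    ∃[ w ] ∃[ l ] u ⟶ w × w ≢ z × Path w l z × z ∉ l × CoversAvoiding u z l
  neighbour⇒secondLast {u} {z} u⟶z x≢u x≢z =
    let 0<κp                  = 0<* {κ} {p} (0<κ u) 0<p
        0<ε                   = 0<quarter {κ * p} 0<κp
        (N , near)            = ℙL→p 0<ε
        (w , u⟶w , w≢z , ≢0)  = decidable-stable (hasSecondLast? N u z) λ none →
          p≰2quarters {κ * p} 0<κp (¬hasSecondLast {ε = quarter (κ * p)} N u⟶z x≢u x≢z 0<ε
            (near N ℕ.≤-refl) (near (suc N) (ℕ.n≤1+n N)) none)
        (l , π , z∉l , 𝟙l≢0)  = 𝔼Hit≢0⇒path N w z (λ l → 𝟙 (coversAvoiding? u z l)) ≢0
    in w , l , u⟶w , w≢z , π , z∉l , 𝟙≢0 (coversAvoiding? u z l) 𝟙l≢0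

  ℙL-near⇒≢0 : ∀ {u z T} → ℙL u z T isWithin quarter p Of p → ℙL u z T ≢ 0ℚ
  ℙL-near⇒≢0 {u} {z} {T} near ≡0 = p≰2quarters {p} 0<p (begin
    p                        ≤⟨ proj₂ near ⟩
    ℙL u z T + quarter p     ≡⟨ cong (_+ quarter p) ≡0 ⟩
    0ℚ + quarter p           ≤⟨ +-monoˡ-≤ (quarter p) (<⇒≤ (0<quarter {p} 0<p)) ⟩
    quarter p + quarter p    ∎)
    where open ≤-Reasoning

  ℙL≢0⇒path : ∀ t {x z} → ℙL x z t ≢ 0ℚ → ∃[ l ] Path x l z × z ∉ l × Covers z l
  ℙL≢0⇒path t {x} {z} ≢0 with 𝔼Hit≢0⇒path t x z (coversWeight z) (≢0 ∘ trans (ℙL≡𝔼Hit x z t))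
  ... | l , π , z∉l , 𝟙l≢0 = l , π , z∉l , 𝟙≢0 (covers? z l) 𝟙l≢0

  -- As `p` is positive, the tour from `x` has ended at `z` with positive probability by some finite
  -- time, and a walk realises this.
  covering-path : ∀ {x z} → x ≢ z → ∃[ l ] Path x l z × z ∉ l × Covers z l
  covering-path {x} {z} x≢z with ℙL→p (0<quarter {p} 0<p)
  ... | N , near = ℙL≢0⇒path N (ℙL-near⇒≢0 {x} {z} {N} (near N ℕ.≤-refl x z x≢z))

  bidirected : ∀ {u v} → u ⟶ v → v ⟶ u
  bidirected = CoveringPaths.bidirected G covering-path non-neighbour⇒never-secondLast neighbour⇒secondLast connected

theorem2 : (n : ℕ) (G : SimpleDigraph n) →
    let open SimpleDigraph G
        open RandomWalk G in
    StronglyConnected →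
    (∀ (u v w : Fin n) → u ≢ v → u ≢ w → v ≢ w → ℙL u v ≃ ℙL u w) →
    ∀ (u v : Fin n) → u ⟶ v → v ⟶ u
theorem2 n G connected uniform u v u⟶v =
  Uniform.bidirected G connected uniform (λ u≡v → SimpleDigraph.irrefl G u≡v u⟶v) u⟶v
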